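{- Let $r,s\ge 1$ and $t\ge 2$ be integers, and let $\rho\in\mathcal{P}_{r,s}$ be a $t$-core. Let $\mathcal{D}^t_{r,s}(\rho)=\{\lambda\in\mathcal{P}_{r,s}\mid \mathrm{core}_t(\lambda)=\rho\}$. Let $n_i=\left\lfloor\frac{r+s+t-1-i}{t}\right\rfloor$ for $0\le i\le t-1$, and let $a_i=|v^i|$, where $(v^0,\dots,v^{t-1})$ is the $t$-tuple of binary words associated to $\rho$ (as a partition in $\mathcal{P}_{r,s}$). Then $$\sum_{\lambda\in\mathcal{D}^t_{r,s}(\rho)}q^{|\lambda|}=q^{|\rho|}\prod_{i=0}^{t-1}\begin{bmatrix} n_i\\ a_i\end{bmatrix}_{q^t}.$$
   Context: A partition $\lambda=(\lambda_1\ge\lambda_2\ge\cdots)$ is a weakly decreasing finite sequence of positive integers (possibly empty), extended by $\lambda_j=0$ for $j>\ell(\lambda)$, where $\ell(\lambda)$ is the number of parts; $|\lambda|=\sum_j\lambda_j$. $\mathcal{P}_{r,s}$ is the set of partitions with $\ell(\lambda)\le r$ and $\lambda_1\le s$. A rim-hook of $\lambda$ is a connected skew shape $\lambda/\mu$ (with $\mu\subseteq\lambda$ a partition) containing no $2\times2$ block of boxes; a $t$-rim hook is one with exactly $t$ boxes. The $t$-core $\mathrm{core}_t(\lambda)$ is the partition obtained by successively removing $t$-rim hooks until none can be removed (it does not depend on the order of removals); $\lambda$ is a $t$-core if $\mathrm{core}_t(\lambda)=\lambda$. Words associated to a partition $\lambda\in\mathcal{P}_{r,s}$: the balanced abacus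 of $\lambda$ is the word $w=(w_m)_{m\in\mathbb{Z}}$ in $\{0,1\}$ with $w_m=1$ if $m=\lambda_j-j$ for some $j\ge1$ and $w_m=0$ otherwise (equivalently, it traces the boundary of $\lambda$ with $1$ for an up step and $0$ for a right step, normalised so that $|\{m\ge0: w_m=1\}|=|\{m<0:w_m=0\}|$). With $n_i=\left\lfloor\frac{r+s+t-1-i}{t}\right\rfloor$, set $$v^i=(w_{ -r+i},\,w_{ -r+i+t},\,\dots,\,w_{ -r+i+t(n_i-1)}),\qquad 0\le i\le t-1.$$ For a binary word $v$, $|v|$ denotes the number of $1$'s in $v$. $\begin{bmatrix} n\\ a\end{bmatrix}_{q}$ denotes the $q$-binomial coefficient (Gaussian polynomial), and the subscript $q^t$ means $q$ is replaced by $q^t$. -}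

module Defs where

open import Algebra.Bundles using (CommutativeSemiring)
open import Data.Bool.Base using (Bool)
open import Data.Fin.Base using (Fin; toℕ)
open import Data.Integer.Base as ℤ using (ℤ; +_; -[1+_])
import Data.Integer.Properties as ℤ
open import Data.List.Base using (List; []; _∷_; length; map; foldr; filterᵇ; applyUpTo)
open import Data.List.Membership.Propositional using (_∈_)
open import Data.List.Membership.Propositional.Properties.WithK using (unique∧set⇒bag)
open import Data.List.Relation.Binary.BagAndSetEquality using (∼bag⇒↭)
open import Data.List.Relation.Binary.Permutation.Propositional using (_↭_)
open import Data.List.Relation.Unary.All using (All)
open import Data.List.Relation.Unary.Linked using (Linked)
open import Data.List.Relation.Unary.Unique.Propositional using (Unique)
open import Data.Nat.Base as ℕ using (ℕ; zero; suc; _≤_; _≥_; _<_; z≤n; s≤s; NonZero)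
import Data.Nat.DivMod as ℕ
open import Data.Nat.ListAction using (sum)
import Data.Nat.Properties as ℕ
open import Data.Product.Base using (∃; _×_; _,_)
open import Function.Base using (id)
open import Function.Bundles using (_⇔_)
open import Function.Construct.Composition using (_⇔-∘_)
open import Function.Construct.Symmetry using (⇔-sym)
open import Level using (Level)
open import Relation.Binary.Construct.Closure.ReflexiveTransitive using (Star)
open import Relation.Binary.PropositionalEquality as ≡ using (_≡_)
open import Relation.Nullary using (¬_; Dec; yes; no; ⌊_⌋)
open import Relation.Unary using (Pred)

private
  variable
    a p : Level

------------------------------------------------------------------------
-- Partitions

record Partition : Set where
  constructor mkPartition
  field
    parts      : List ℕ
    decreasing : Linked _≥_ parts
    positive   : All (0 <_) parts

open Partition public

size : Partition → ℕ
size ν = sum (parts ν)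

nth : List ℕ → ℕ → ℕ
nth []       _       = 0
nth (x ∷ _)  zero    = x
nth (_ ∷ xs) (suc j) = nth xs j

-- Indices start at 0: part ν j is the usual ν_{j+1}.
part : Partition → ℕ → ℕ
part ν = nth (parts ν)

_∈𝒫[_,_] : Partition → ℕ → ℕ → Set
ν ∈𝒫[ r , s ] = length (parts ν) ≤ r × part ν 0 ≤ s

------------------------------------------------------------------------
-- Rim hooks and cores

Box : Set
Box = ℕ × ℕ

_⊆_ : Partition → Partition → Set
μ ⊆ ν = ∀ i → part μ i ≤ part ν i

-- The boxes, as (row , column), of the skew shape ν/μ.
Skew : Partition → Partition → Pred Box _
Skew ν μ (i , j) = part μ i ≤ j × j < part ν i

data Adjacent : Box → Box → Set where
  right : ∀ {i j} → Adjacent (i , j) (i , suc j)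
  left  : ∀ {i j} → Adjacent (i , suc j) (i , j)
  down  : ∀ {i j} → Adjacent (i , j) (suc i , j)
  up    : ∀ {i j} → Adjacent (suc i , j) (i , j)

Step : Pred Box _ → Box → Box → Set
Step S b c = S b × S c × Adjacent b c

Connected : Pred Box _ → Set
Connected S = ∀ b c → S b → S c → Star (Step S) b c

No2×2 : Pred Box _ → Set
No2×2 S = ∀ i j → ¬ (S (i , j) × S (i , suc j) × S (suc i , j) × S (suc i , suc j))

-- ν/μ is a rim hook of ν.
RimHook : Partition → Partition → Set
RimHook ν μ = μ ⊆ ν × Connected (Skew ν μ) × No2×2 (Skew ν μ)

-- μ is obtained from ν by removing a t-rim hook; since μ ⊆ ν, the last
-- component says that ν/μ has exactly t boxes.
Removes : ℕ → Partition → Partition → Set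
Removes t ν μ = RimHook ν μ × size ν ≡ size μ ℕ.+ t

-- core_t(ν) = κ, as a relation: some sequence of removals of t-rim hooks
-- leads from ν to κ, where no further removal is possible.
CoreOf : ℕ → Partition → Partition → Set
CoreOf t ν κ = Star (Removes t) ν κ × ¬ ∃ (Removes t κ)

IsCore : ℕ → Partition → Set
IsCore t ν = CoreOf t ν ν

𝒟 : (t r s : ℕ) → Partition → Pred Partition _
𝒟 t r s ρ ν = ν ∈𝒫[ r , s ] × CoreOf t ν ρ

------------------------------------------------------------------------
-- The balanced abacus and its t-tuple of words

-- With 0-based j this is m = ν_{j+1} - (j+1).
Bead : Partition → ℤ → ℕ → Set
Bead ν m j = m ≡ + part ν j ℤ.- + suc j

private
  nth-beyond : ∀ xs j → length xs ≤ j → nth xs j ≡ 0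
  nth-beyond []       _       _         = ≡.refl
  nth-beyond (_ ∷ xs) (suc j) (s≤s l≤j) = nth-beyond xs j l≤j

bead? : ∀ ν m → Dec (∃ (Bead ν m))
bead? ν m with ℕ.anyUpTo? (λ j → m ℤ.≟ + part ν j ℤ.- + suc j) (length (parts ν))
... | yes (j , _ , e) = yes (j , e)
... | no ¬small = beyond m ¬small
  where
  l = length (parts ν)

  -- Past the last part, the beads are the integers -(j+1).
  at : ∀ {m j} → l ≤ j → Bead ν m j → m ≡ -[1+ j ]
  at {j = j} l≤j e =
    ≡.trans e (≡.cong (λ x → + x ℤ.- + suc j) (nth-beyond (parts ν) j l≤j))

  big : ∀ {m j} → ¬ (∃ λ j → j < l × Bead ν m j) → Bead ν m j → l ≤ j
  big ¬s e = ℕ.≮⇒≥ λ j<l → ¬s (_ , j<l , e)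

  beyond : ∀ m → ¬ (∃ λ j → j < l × Bead ν m j) → Dec (∃ (Bead ν m))
  beyond (+ n) ¬s = no λ { (j , e) → case-⊥ (at (big ¬s e) e) }
    where
    case-⊥ : ∀ {j} → ¬ (+ n ≡ -[1+ j ])
    case-⊥ ()
  beyond -[1+ k ] ¬s with l ℕ.≤? k
  ... | yes l≤k = yes (k , ≡.cong (λ x → + x ℤ.- + suc k)
                                  (≡.sym (nth-beyond (parts ν) k l≤k)))
  ... | no  l≰k = no λ { (j , e) → l≰k (≡.subst (l ≤_)
                    (≡.sym (ℤ.-[1+-injective (at (big ¬s e) e))) (big ¬s e)) }

-- The letter w_m, with true for 1 and false for 0.
abacus : Partition → ℤ → Bool
abacus ν m = ⌊ bead? ν m ⌋

wordLength : (r s t i : ℕ) → .{{_ : NonZero t}} → ℕ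
wordLength r s t i = (r ℕ.+ s ℕ.+ t ℕ.∸ 1 ℕ.∸ i) ℕ./ t

word : (r s t : ℕ) → .{{_ : NonZero t}} → Partition → ℕ → List Bool
word r s t ν i =
  applyUpTo (λ k → abacus ν (ℤ.- + r ℤ.+ + i ℤ.+ + (t ℕ.* k))) (wordLength r s t i)

ones : List Bool → ℕ
ones v = length (filterᵇ id v)

------------------------------------------------------------------------
-- Finite sets of summation

Enumerates : {A : Set a} → List A → Pred A p → Set _
Enumerates xs P = Unique xs × (∀ x → x ∈ xs ⇔ P x)

-- Hence a commutative sum over an enumeration of P depends only on P.
Enumerates-↭ : {A : Set a} {P : Pred A p} {xs ys : List A} →
               Enumerates xs P → Enumerates ys P → xs ↭ ys
Enumerates-↭ (ux , ex) (uy , ey) =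
  ∼bag⇒↭ (unique∧set⇒bag ux uy λ {x} → ⇔-sym (ey x) ⇔-∘ ex x)

------------------------------------------------------------------------
-- Polynomials in q, with coefficients in ℕ, evaluated at an element of a
-- commutative semiring.  An identity valid for all R and all q is the
-- same as an identity in ℕ[q] (take R = ℕ[q] with q the indeterminate).

module QPoly {c ℓ} (R : CommutativeSemiring c ℓ) where

  open CommutativeSemiring R hiding (zero)
  open import Algebra.Properties.Semiring.Exp semiring public using (_^_)
  open import Algebra.Properties.CommutativeMonoid.Sum *-commutativeMonoid
    using () renaming (sum to ∏Fin)

  ∑ : {A : Set a} → List A → (A → Carrier) → Carrier
  ∑ xs f = foldr _+_ 0# (map f xs)

  -- The product of f i over 0 ≤ i ≤ n - 1.
  ∏ : ℕ → (ℕ → Carrier) → Carrier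
  ∏ n f = ∏Fin {n} (λ i → f (toℕ i))

  -- The Gaussian polynomial [n choose k]_q, by its q-Pascal rule.  A
  -- semiring has no division or subtraction, so its quotient formula
  -- [n]! / ([k]! [n-k]!) is proved below as gauss-factorial.
  gauss : Carrier → ℕ → ℕ → Carrier
  gauss q _       zero    = 1#
  gauss q zero    (suc k) = 0#
  gauss q (suc n) (suc k) = gauss q n k + q ^ suc k * gauss q n (suc k)

  [_] : ℕ → Carrier → Carrier
  [ zero ]  q = 0#
  [ suc n ] q = 1# + q * [ n ] q

  [_]! : ℕ → Carrier → Carrier
  [ zero ]!  q = 1#
  [ suc n ]! q = [ suc n ] q * [ n ]! q

  open import Relation.Binary.Reasoning.Setoid setoid
  open import Algebra.Properties.CommutativeSemigroup *-commutativeSemigroup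
    using (x∙yz≈y∙xz)

  gauss-beyond : ∀ q {n k} → n < k → gauss q n k ≈ 0#
  gauss-beyond q {zero}  {suc k} _         = refl
  gauss-beyond q {suc n} {suc k} (s≤s n<k) = begin
    gauss q n k + q ^ suc k * gauss q n (suc k)
      ≈⟨ +-cong (gauss-beyond q n<k) (*-congˡ (gauss-beyond q (ℕ.m≤n⇒m≤1+n n<k))) ⟩
    0# + q ^ suc k * 0#  ≈⟨ +-identityˡ _ ⟩
    q ^ suc k * 0#       ≈⟨ zeroʳ _ ⟩
    0#                   ∎

  private
    gauss-diagonal : ∀ q n → gauss q n n ≈ 1#
    gauss-diagonal q zero    = refl
    gauss-diagonal q (suc n) = begin
      gauss q n n + q ^ suc n * gauss q n (suc n)
        ≈⟨ +-cong (gauss-diagonal q n) (*-congˡ (gauss-beyond q (ℕ.n<1+n n))) ⟩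
      1# + q ^ suc n * 0#  ≈⟨ +-congˡ (zeroʳ _) ⟩
      1# + 0#              ≈⟨ +-identityʳ _ ⟩
      1#                   ∎

    [+] : ∀ q m n → [ m ] q + q ^ m * [ n ] q ≈ [ m ℕ.+ n ] q
    [+] q zero    n = trans (+-identityˡ _) (*-identityˡ _)
    [+] q (suc m) n = begin
      1# + q * [ m ] q + q * q ^ m * [ n ] q    ≈⟨ +-assoc _ _ _ ⟩
      1# + (q * [ m ] q + q * q ^ m * [ n ] q)  ≈⟨ +-congˡ (+-congˡ (*-assoc _ _ _)) ⟩
      1# + (q * [ m ] q + q * (q ^ m * [ n ] q)) ≈⟨ +-congˡ (distribˡ _ _ _) ⟨
      1# + q * ([ m ] q + q ^ m * [ n ] q)      ≈⟨ +-congˡ (*-congˡ ([+] q m n)) ⟩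
      1# + q * [ m ℕ.+ n ] q                    ∎

  gauss-factorial : ∀ q k l →
    gauss q (k ℕ.+ l) k * ([ k ]! q * [ l ]! q) ≈ [ k ℕ.+ l ]! q
  gauss-factorial q zero    l = trans (*-identityˡ _) (*-identityˡ _)
  gauss-factorial q (suc k) zero rewrite ℕ.+-identityʳ k = begin
    gauss q (suc k) (suc k) * ([ suc k ]! q * 1#)
      ≈⟨ *-cong (gauss-diagonal q (suc k)) (*-identityʳ _) ⟩
    1# * [ suc k ]! q  ≈⟨ *-identityˡ _ ⟩
    [ suc k ]! q       ∎
  gauss-factorial q (suc k) (suc l) = begin
    (g₀ + x * g₁) * (K! * L!)              ≈⟨ distribʳ _ _ _ ⟩
    g₀ * (K! * L!) + x * g₁ * (K! * L!)    ≈⟨ +-cong first second ⟩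
    [ suc k ] q * N! + x * [ suc l ] q * N! ≈⟨ distribʳ _ _ _ ⟨
    ([ suc k ] q + x * [ suc l ] q) * N!   ≈⟨ *-congʳ ([+] q (suc k) (suc l)) ⟩
    [ suc k ℕ.+ suc l ] q * N!             ∎
    where
    x  = q ^ suc k
    g₀ = gauss q (k ℕ.+ suc l) k
    g₁ = gauss q (k ℕ.+ suc l) (suc k)
    K! = [ suc k ]! q
    L! = [ suc l ]! q
    N! = [ k ℕ.+ suc l ]! q

    first : g₀ * (K! * L!) ≈ [ suc k ] q * N!
    first = begin
      g₀ * ([ suc k ] q * [ k ]! q * L!)   ≈⟨ *-congˡ (*-assoc _ _ _) ⟩
      g₀ * ([ suc k ] q * ([ k ]! q * L!)) ≈⟨ x∙yz≈y∙xz _ _ _ ⟩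
      [ suc k ] q * (g₀ * ([ k ]! q * L!)) ≈⟨ *-congˡ (gauss-factorial q k (suc l)) ⟩
      [ suc k ] q * N!                     ∎

    shifted : g₁ * (K! * [ l ]! q) ≈ N!
    shifted rewrite ℕ.+-suc k l = gauss-factorial q (suc k) l

    second : x * g₁ * (K! * L!) ≈ x * [ suc l ] q * N!
    second = begin
      x * g₁ * (K! * ([ suc l ] q * [ l ]! q))   ≈⟨ *-assoc _ _ _ ⟩
      x * (g₁ * (K! * ([ suc l ] q * [ l ]! q))) ≈⟨ *-congˡ (*-congˡ (x∙yz≈y∙xz _ _ _)) ⟩
      x * (g₁ * ([ suc l ] q * (K! * [ l ]! q))) ≈⟨ *-congˡ (x∙yz≈y∙xz _ _ _) ⟩
      x * ([ suc l ] q * (g₁ * (K! * [ l ]! q))) ≈⟨ *-congˡ (*-congˡ shifted) ⟩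
      x * ([ suc l ] q * N!)                     ≈⟨ *-assoc _ _ _ ⟨
      x * [ suc l ] q * N!                       ∎

-- A partition in 𝒫_{r,s} is the same as a placement of r beads on the
-- positions 0, …, r+s-1.  Removing a t-rim hook slides one bead from x to
-- x - t, so if the positions are split into t runners by residue mod t, it
-- turns one adjacent pair 01 of one of the words vⁱ into 10.  This keeps the
-- length and the number of ones of each vⁱ and lowers the total number of
-- inversions by one; since ρ is a t-core, its words have no inversions at all.
-- Conversely each tuple of words with these lengths and numbers of ones can be
-- sorted by such moves, and then undoing the moves starting from ρ reaches it.
-- Hence |λ| = |ρ| + t · (inversions of λ), and the inversions of binary words
-- of length n with a ones are counted by the Gaussian polynomial.
module Submission where

open import Algebra.Bundles using (CommutativeSemiring)
open import Data.Bool.Base using (Bool; true; false)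
open import Data.Integer.Base as ℤ using (+_)
import Data.Integer.Properties as ℤ
import Data.Integer.Tactic.RingSolver as ℤ-Solver
open import Data.List.Base using (List; []; _∷_; _++_; length; map; applyUpTo; replicate; cartesianProductWith)
open import Data.List.Membership.Propositional using (_∈_)
open import Data.List.Membership.Propositional.Properties
open import Data.List.Properties using (∷-injective; length-applyUpTo; map-applyUpTo)
open import Data.List.Relation.Binary.Pointwise using (Pointwise; []; _∷_)
open import Data.List.Relation.Unary.All as All using (All; []; _∷_)
open import Data.List.Relation.Unary.Any using (here; there)
open import Data.List.Relation.Unary.Linked as Linked using (Linked; []; [-]; _∷_)
open import Data.List.Relation.Unary.Unique.Propositional using (Unique; []; _∷_)
import Data.List.Relation.Unary.Unique.Propositional.Properties as Unique
open import Data.Nat.Base as Nat hiding (_*_; _^_)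
open import Data.Nat.DivMod
open import Data.Nat.ListAction using (sum)
open import Data.Nat.Properties
open import Data.Nat.Tactic.RingSolver using (solve-∀)
open import Data.Product.Base using (∃; ∃₂; _×_; _,_; proj₁; proj₂)
open import Data.Sum.Base using (_⊎_; inj₁; inj₂)
open import Function.Base using (_∘_; case_of_)
open import Function.Bundles using (_⇔_; mk⇔; Equivalence)
open import Level using (Level)
open import Relation.Binary.Construct.Closure.ReflexiveTransitive as Star using (Star; ε; _◅_; _◅◅_)
open import Relation.Binary.Definitions using (tri<; tri≈; tri>)
open import Relation.Binary.PropositionalEquality hiding (J; setoid)
open import Relation.Nullary using (¬_; Dec; yes; no; contradiction; ⌊_⌋)
open import Relation.Nullary.Decidable using (map′)
open import Relation.Unary using (Pred)
open import Defs

-- A rim hook is defined by paths and blocks, while a slide of a bead concerns row lengths. `Hook`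
-- bridges the two: connectedness gives `g i < f (suc i)` between consecutive rows of the skew
-- shape, the absence of 2×2 blocks gives `f (suc i) ≤ suc (g i)`, and the resulting equality says
-- that the other beads of the hook merely change rows. Partitions are handled as antitone functions
-- on ℕ, which can be cut and shifted by rows without touching lists. Slides are needed in both
-- directions: a slide down turns a pair 01 in the words of ρ into a removable hook, which a core
-- forbids, and a slide up realises a prescribed tuple of words. The list of summation is obtained
-- by realising every admissible tuple, with the removals and the size carried along; it is complete
-- because inside the box the words determine the partition.

Antitone : (ℕ → ℕ) → Set
Antitone f = ∀ i → f (suc i) ≤ f i

antitone-≤ : ∀ {f} → Antitone f → ∀ {i j} → i ≤ j → f j ≤ f i
antitone-≤ {f} anti i≤j = go (≤⇒≤′ i≤j)
  where
  go : ∀ {i j} → i ≤′ j → f j ≤ f i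
  go ≤′-refl       = ≤-refl
  go (≤′-step i≤j) = ≤-trans (anti _) (go i≤j)

-- Partitions as antitone functions

nth-antitone : ∀ {xs} → Linked _≥_ xs → Antitone (nth xs)
nth-antitone []           _       = z≤n
nth-antitone [-]          zero    = z≤n
nth-antitone [-]          (suc _) = z≤n
nth-antitone (x≥y ∷ _)    zero    = x≥y
nth-antitone (_ ∷ linked) (suc i) = nth-antitone linked i

part-antitone : ∀ ν → Antitone (part ν)
part-antitone ν = nth-antitone (decreasing ν)

nth-beyond : ∀ xs {j} → length xs ≤ j → nth xs j ≡ 0
nth-beyond []       _         = refl
nth-beyond (_ ∷ xs) (s≤s l≤j) = nth-beyond xs l≤j

nth≡0⇒length≤ : ∀ {xs n} → All (0 <_) xs → nth xs n ≡ 0 → length xs ≤ n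
nth≡0⇒length≤             []        _   = z≤n
nth≡0⇒length≤ {n = zero}  (0<x ∷ _) x≡0 = contradiction (sym x≡0) (<⇒≢ 0<x)
nth≡0⇒length≤ {n = suc n} (_ ∷ pos) eq  = s≤s (nth≡0⇒length≤ pos eq)

-- Since `nth` is 0 past the end, two different lists could agree only by trailing zeros, which
-- positivity excludes.
nth-injective : ∀ {xs ys} → All (0 <_) xs → All (0 <_) ys → nth xs ≗ nth ys → xs ≡ ys
nth-injective []        []        _  = refl
nth-injective []        (0<y ∷ _) eq = contradiction (eq 0) (<⇒≢ 0<y)
nth-injective (0<x ∷ _) []        eq = contradiction (sym (eq 0)) (<⇒≢ 0<x)
nth-injective (_ ∷ px)  (_ ∷ py)  eq = cong₂ _∷_ (eq 0) (nth-injective px py (eq ∘ suc))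

part-injective : ∀ {ν ν′} → part ν ≗ part ν′ → ν ≡ ν′
part-injective {mkPartition xs d p} {mkPartition ys d′ p′} eq with nth-injective p p′ eq
... | refl = cong₂ (mkPartition xs) (Linked.irrelevant ≤-irrelevant d d′)
                                    (All.irrelevant ≤-irrelevant p p′)

linked-∷ : ∀ {x xs} → nth xs 0 ≤ x → Linked _≥_ xs → Linked _≥_ (x ∷ xs)
linked-∷ {xs = []}    _   _      = [-]
linked-∷ {xs = _ ∷ _} y≤x linked = y≤x ∷ linked

-- The list is cut at the first zero of `f`, after which antitonicity leaves only zeros; the index
-- `n` of an empty row bounds the recursion.
fromParts : ∀ n {f} → Antitone f → f n ≡ 0 →
            ∃ λ ν → part ν ≗ f × length (parts ν) ≤ n
fromParts n {f} anti fn≡0 with f 0 in f0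
... | zero = mkPartition [] [] [] ,
             (λ i → sym (n≤0⇒n≡0 (subst (f i ≤_) f0 (antitone-≤ anti z≤n)))) , z≤n
... | suc _ with n
...   | zero  = contradiction (trans (sym f0) fn≡0) λ ()
...   | suc m with fromParts m {f ∘ suc} (anti ∘ suc) fn≡0
...     | mkPartition xs d p , eq , l≤m =
  mkPartition (f 0 ∷ xs) (linked-∷ (subst (_≤ f 0) (sym (eq 0)) (anti 0)) d)
              (subst (0 <_) (sym f0) z<s ∷ p) ,
  (λ { zero → refl ; (suc i) → eq i }) , s≤s l≤m

-- Sizes as sums over rows

Σ< : ℕ → (ℕ → ℕ) → ℕ
Σ< zero    f = 0
Σ< (suc n) f = f 0 + Σ< n (f ∘ suc)

Σ<-cong : ∀ n {f g} → f ≗ g → Σ< n f ≡ Σ< n g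
Σ<-cong zero    _  = refl
Σ<-cong (suc n) eq = cong₂ _+_ (eq 0) (Σ<-cong n (eq ∘ suc))

sum≡Σ<nth : ∀ xs n → length xs ≤ n → sum xs ≡ Σ< n (nth xs)
sum≡Σ<nth []       zero    _         = refl
sum≡Σ<nth []       (suc n) _         = sum≡Σ<nth [] n z≤n
sum≡Σ<nth (x ∷ xs) (suc n) (s≤s l≤n) = cong (_+_ x) (sum≡Σ<nth xs n l≤n)

size≡Σ< : ∀ ν {n} → part ν n ≡ 0 → size ν ≡ Σ< n (part ν)
size≡Σ< ν {n} eq = sum≡Σ<nth (parts ν) n (nth≡0⇒length≤ (positive ν) eq)

-- Rim hooks

-- The rows of a rim hook f/g are a, …, b.  In terms of beads, the bead of
-- row suc i of f becomes the bead of row i of g for a ≤ i < b, so that only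
-- the bead of row a of f disappears and only that of row b of g is new.
record Hook (f g : ℕ → ℕ) (a b : ℕ) : Set where
  field
    a≤b    : a ≤ b
    above  : ∀ {i} → i < a → f i ≡ g i
    inside : ∀ {i} → a ≤ i → i < b → f (suc i) ≡ suc (g i)
    end    : g b < f b
    below  : ∀ {i} → b < i → f i ≡ g i

Hook-cong : ∀ {f f′ g g′ a b} → f ≗ f′ → g ≗ g′ → Hook f g a b → Hook f′ g′ a b
Hook-cong f≗ g≗ h = record
  { a≤b    = a≤b
  ; above  = λ i<a → trans (sym (f≗ _)) (trans (above i<a) (g≗ _))
  ; inside = λ a≤i i<b → trans (sym (f≗ _)) (trans (inside a≤i i<b) (cong suc (g≗ _)))
  ; end    = subst₂ _<_ (g≗ _) (f≗ _) end
  ; below  = λ b<i → trans (sym (f≗ _)) (trans (below b<i) (g≗ _))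
  }
  where open Hook h

-- A telescoping sum: row `suc i` of `f` cancels row `i` of `g` up to one box, for each of the `b`
-- inner steps, so that only `f 0`, `g b` and `b` survive. The negative terms are moved across to
-- stay in ℕ.
Hook-Σ<-from0 : ∀ {f g b} → Hook f g 0 b → ∀ {n} → b < n →
                Σ< n f + g b ≡ Σ< n g + (f 0 + b)
Hook-Σ<-from0 {f} {g} {zero} h {suc n} _
  rewrite Σ<-cong n {f ∘ suc} {g ∘ suc} (λ i → Hook.below h z<s) =
  lemma (f 0) (g 0) (Σ< n (g ∘ suc))
  where
  lemma : ∀ x y z → x + z + y ≡ y + z + (x + 0)
  lemma = solve-∀
Hook-Σ<-from0 {f} {g} {suc b} h {suc n} (s≤s b<n) = begin
  f 0 + F + g (suc b)         ≡⟨ +-assoc (f 0) F _ ⟩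
  f 0 + (F + g (suc b))       ≡⟨ cong (_+_ (f 0)) (Hook-Σ<-from0 tail b<n) ⟩
  f 0 + (G + (f 1 + b))       ≡⟨ cong (λ x → f 0 + (G + (x + b))) (Hook.inside h z≤n z<s) ⟩
  f 0 + (G + (suc (g 0) + b)) ≡⟨ lemma (f 0) (g 0) G b ⟩
  g 0 + G + (f 0 + suc b)     ∎
  where
  open ≡-Reasoning
  F = Σ< n (f ∘ suc)
  G = Σ< n (g ∘ suc)
  tail : Hook (f ∘ suc) (g ∘ suc) 0 b
  tail = record
    { a≤b = z≤n ; above = λ () ; inside = λ _ i<b → Hook.inside h z≤n (s≤s i<b)
    ; end = Hook.end h ; below = Hook.below h ∘ s≤s }
  lemma : ∀ x y z w → x + (z + (suc y + w)) ≡ y + z + (x + suc w)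
  lemma = solve-∀

-- The number of boxes of the hook is `(f a - a) - (g b - b)`, the distance between the vanishing
-- bead and the new one.
Hook-Σ< : ∀ {f g a b} → Hook f g a b → ∀ {n} → b < n →
          Σ< n f + (g b + a) ≡ Σ< n g + (f a + b)
Hook-Σ< {f} {g} {zero} {b} h {n} b<n =
  trans (cong (_+_ (Σ< n f)) (+-identityʳ (g b))) (Hook-Σ<-from0 h b<n)
Hook-Σ< {a = suc a} {zero} h _ = contradiction (Hook.a≤b h) λ ()
Hook-Σ< {f} {g} {suc a} {suc b} h {suc n} (s≤s b<n) = begin
  f 0 + F + (g (suc b) + suc a)   ≡⟨ lemma (f 0) F _ a ⟩
  suc (f 0) + (F + (g (suc b) + a)) ≡⟨ cong₂ (λ x y → suc x + y) (Hook.above h z<s) (Hook-Σ< tail b<n) ⟩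
  suc (g 0) + (G + (f (suc a) + b)) ≡⟨ lemma (g 0) G _ b ⟨
  g 0 + G + (f (suc a) + suc b)   ∎
  where
  open ≡-Reasoning
  F = Σ< n (f ∘ suc)
  G = Σ< n (g ∘ suc)
  tail : Hook (f ∘ suc) (g ∘ suc) a b
  tail = record
    { a≤b = ≤-pred (Hook.a≤b h) ; above = Hook.above h ∘ s≤s
    ; inside = λ a≤i i<b → Hook.inside h (s≤s a≤i) (s≤s i<b)
    ; end = Hook.end h ; below = Hook.below h ∘ s≤s }
  lemma : ∀ x y z w → x + y + (z + suc w) ≡ suc x + (y + (z + w))
  lemma = solve-∀

module _ {f g : ℕ → ℕ} {a b : ℕ} (f-anti : Antitone f) (g-anti : Antitone g) (h : Hook f g a b) where
  open Hook h

  Hook-sub : ∀ i → g i ≤ f i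
  Hook-sub i with <-≤-connex i a
  ... | inj₁ i<a = ≤-reflexive (sym (above i<a))
  ... | inj₂ a≤i with <-cmp i b
  ...   | tri< i<b _ _    = ≤-trans (n≤1+n _) (subst (_≤ f i) (inside a≤i i<b) (f-anti i))
  ...   | tri≈ _ refl _   = <⇒≤ end
  ...   | tri> _ _ b<i    = ≤-reflexive (sym (below b<i))

  -- This is the absence of 2×2 blocks: rows `i` and `suc i` of the skew shape share at most one
  -- column.
  Hook-thin : ∀ i → f (suc i) ≤ suc (g i)
  Hook-thin i with <-≤-connex i a
  ... | inj₁ i<a = ≤-trans (f-anti i) (≤-trans (≤-reflexive (above i<a)) (n≤1+n _))
  ... | inj₂ a≤i with <-≤-connex i b
  ...   | inj₁ i<b = ≤-reflexive (inside a≤i i<b)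
  ...   | inj₂ b≤i = ≤-trans (≤-reflexive (below (s≤s b≤i))) (≤-trans (g-anti i) (n≤1+n _))

  Hook-start : g a < f a
  Hook-start with m≤n⇒m<n∨m≡n a≤b
  ... | inj₁ a<b  = subst (_≤ f a) (inside ≤-refl a<b) (f-anti a)
  ... | inj₂ refl = end

  Hook-rows : ∀ {i} → g i < f i → a ≤ i × i ≤ b
  Hook-rows lt = ≮⇒≥ (λ i<a → <⇒≢ lt (sym (above i<a))) ,
                 ≮⇒≥ (λ b<i → <⇒≢ lt (sym (below b<i)))

-- Extremal rows and paths of boxes

module _ {p} {P : Pred ℕ p} (P? : ∀ i → Dec (P i)) where

  least : ∀ {n} → P n → ∃ λ a → a ≤ n × P a × (∀ {i} → i < a → ¬ P i)
  least {n} Pn with go n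
    where
    go : ∀ n → (∀ {i} → i < n → ¬ P i) ⊎ ∃ λ a → a < n × P a × (∀ {i} → i < a → ¬ P i)
    go zero = inj₁ λ ()
    go (suc n) with go n
    ... | inj₂ (a , a<n , rest) = inj₂ (a , m≤n⇒m≤1+n a<n , rest)
    ... | inj₁ none with P? n
    ...   | yes Pn = inj₂ (n , ≤-refl , Pn , none)
    ...   | no ¬Pn = inj₁ λ i<1+n → case m≤n⇒m<n∨m≡n (≤-pred i<1+n) of λ
                       { (inj₁ i<n) → none i<n ; (inj₂ refl) → ¬Pn }
  ... | inj₁ none                 = n , ≤-refl , Pn , none
  ... | inj₂ (a , a<n , Pa , min) = a , <⇒≤ a<n , Pa , min

  greatest : ∀ n {m} → P m → (∀ {i} → n ≤ i → ¬ P i) →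
             ∃ λ b → m ≤ b × P b × (∀ {i} → b < i → ¬ P i)
  greatest zero    Pm bound = contradiction Pm (bound z≤n)
  greatest (suc n) Pm bound with P? n
  ... | yes Pn = n , ≮⇒≥ (λ n<m → bound n<m Pm) , Pn , bound
  ... | no ¬Pn = greatest n Pm λ n≤i → case m≤n⇒m<n∨m≡n n≤i of λ
                   { (inj₁ n<i) → bound n<i ; (inj₂ refl) → ¬Pn }

-- A discrete intermediate value argument: a path that ends below row `i` has to leave it by a step
-- down, whose two boxes share a column.
crossing : ∀ {S : Pred Box _} {i i₁ i₂ j₁ j₂} → Star (Step S) (i₁ , j₁) (i₂ , j₂) →
           i₁ ≤ i → i < i₂ → ∃ λ j → S (i , j) × S (suc i , j)
crossing ε                      i₁≤i i<i₂ = contradiction i<i₂ (≤⇒≯ i₁≤i)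
crossing ((_ , _ , right) ◅ ps) i₁≤i i<i₂ = crossing ps i₁≤i i<i₂
crossing ((_ , _ , left)  ◅ ps) i₁≤i i<i₂ = crossing ps i₁≤i i<i₂
crossing ((_ , _ , up)    ◅ ps) i₁≤i i<i₂ = crossing ps (≤-trans (n≤1+n _) i₁≤i) i<i₂
crossing ((s , s′ , down) ◅ ps) i₁≤i i<i₂ with m≤n⇒m<n∨m≡n i₁≤i
... | inj₁ i₁<i = crossing ps i₁<i i<i₂
... | inj₂ refl = _ , s , s′

common-zero : ∀ ν μ n → ∃ λ m → n < m × part ν m ≡ 0 × part μ m ≡ 0
common-zero ν μ n = suc n + (l + k) , m≤m+n (suc n) _ ,
  nth-beyond (parts ν) (≤-trans (m≤m+n l k) (m≤n+m _ (suc n))) ,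
  nth-beyond (parts μ) (≤-trans (m≤n+m k l) (m≤n+m _ (suc n)))
  where
  l = length (parts ν)
  k = length (parts μ)

Hook-size : ∀ ν μ {a b} → Hook (part ν) (part μ) a b →
            size ν + (part μ b + a) ≡ size μ + (part ν a + b)
Hook-size ν μ {b = b} h with common-zero ν μ b
... | n , b<n , ν≡0 , μ≡0 rewrite size≡Σ< ν ν≡0 | size≡Σ< μ μ≡0 = Hook-Σ< h b<n

-- Rim hooks described by their rows

removes⇒hook : ∀ {t ν μ} → 1 ≤ t → Removes t ν μ →
               ∃₂ λ a b → Hook (part ν) (part μ) a b × part μ b + t + a ≡ part ν a + b
removes⇒hook {t} {ν} {μ} 1≤t ((μ⊆ν , conn , thin) , size≡) =
  a , b , hook , +-cancelˡ-≡ (size μ) _ _ (begin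
    size μ + (part μ b + t + a)   ≡⟨ lemma (size μ) (part μ b) t a ⟩
    (size μ + t) + (part μ b + a) ≡⟨ cong (_+ (part μ b + a)) size≡ ⟨
    size ν + (part μ b + a)       ≡⟨ Hook-size ν μ hook ⟩
    size μ + (part ν a + b)       ∎)
  where
  open ≡-Reasoning
  lemma : ∀ x y z w → x + (y + z + w) ≡ (x + z) + (y + w)
  lemma = solve-∀

  Row : ℕ → Set
  Row i = part μ i < part ν i

  bound : ∀ {i} → length (parts ν) ≤ i → ¬ Row i
  bound l≤i row = n≮0 (subst (part μ _ <_) (nth-beyond (parts ν) l≤i) row)

  row? : ∀ i → Dec (Row i)
  row? i = part μ i <? part ν i

  ¬row : ∀ {i} → ¬ Row i → part ν i ≡ part μ i
  ¬row ¬r = ≤-antisym (≮⇒≥ ¬r) (μ⊆ν _)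

  nonempty : ∃ Row
  nonempty with anyUpTo? row? (length (parts ν))
  ... | yes (i , _ , row) = i , row
  ... | no none = contradiction (+-cancelˡ-≡ (size μ) _ _ (trans (sym size≡) sizes))
                                (λ t≡0 → <⇒≢ 1≤t (sym t≡0))
    where
    eq : part ν ≗ part μ
    eq i = ¬row λ row → none (i , ≰⇒> (λ l≤i → bound l≤i row) , row)
    sizes : size ν ≡ size μ + 0
    sizes = trans (cong size (part-injective {ν} {μ} eq)) (sym (+-identityʳ _))

  -- The extreme nonempty rows of the skew shape; `least` needs a witness to bound its search, and
  -- row `b` serves.
  last = greatest row? _ (proj₂ nonempty) bound
  b = proj₁ last
  first = least row? (proj₁ (proj₂ (proj₂ last)))
  a = proj₁ first

  in-row : ∀ {i} → Row i → Skew ν μ (i , part μ i)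
  in-row row = ≤-refl , row

  hook : Hook (part ν) (part μ) a b
  hook = record
    { a≤b    = proj₁ (proj₂ first)
    ; above  = λ i<a → ¬row (proj₂ (proj₂ (proj₂ first)) i<a)
    ; inside = inside
    ; end    = proj₁ (proj₂ (proj₂ last))
    ; below  = λ b<i → ¬row (proj₂ (proj₂ (proj₂ last)) b<i)
    }
    where
    inside : ∀ {i} → a ≤ i → i < b → part ν (suc i) ≡ suc (part μ i)
    inside {i} a≤i i<b
      with crossing (conn _ _ (in-row (proj₁ (proj₂ (proj₂ first))))
                              (in-row (proj₁ (proj₂ (proj₂ last))))) a≤i i<b
    -- The shared column `j` gives `part μ i < part ν (suc i)`. If the inequality were strict by two
    -- or more, columns `part μ i` and its successor would form a 2×2 block in rows `i` and `suc i`.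
    ... | j , (μi≤j , _) , (_ , j<νi+1) = ≤-antisym
      (≮⇒≥ λ μi+1<νi+1 → thin i (part μ i)
        ( (≤-refl , ≤-trans (n≤1+n _) (≤-trans μi+1<νi+1 (part-antitone ν i)))
        , (n≤1+n _ , ≤-trans μi+1<νi+1 (part-antitone ν i))
        , (part-antitone μ i , ≤-trans (n≤1+n _) μi+1<νi+1)
        , (≤-trans (part-antitone μ i) (n≤1+n _) , μi+1<νi+1)))
      (≤-trans (s≤s μi≤j) j<νi+1)

Adjacent-sym : ∀ {b c} → Adjacent b c → Adjacent c b
Adjacent-sym right = left
Adjacent-sym left  = right
Adjacent-sym down  = up
Adjacent-sym up    = down

reversePath : ∀ {S : Pred Box _} {b c} → Star (Step S) b c → Star (Step S) c b
reversePath = Star.reverse λ (s , s′ , adj) → s′ , s , Adjacent-sym adj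

hook⇒removes : ∀ {t ν μ a b} → Hook (part ν) (part μ) a b →
               part μ b + t + a ≡ part ν a + b → Removes t ν μ
hook⇒removes {t} {ν} {μ} {a} {b} h eq = (Hook-sub ν↓ μ↓ h , connected , thin) , size≡
  where
  ν↓ = part-antitone ν
  μ↓ = part-antitone μ

  thin : No2×2 (Skew ν μ)
  thin i j ((μi≤j , _) , _ , _ , _ , j+1<νi+1) =
    <⇒≱ j+1<νi+1 (≤-trans (Hook-thin ν↓ μ↓ h i) (s≤s μi≤j))

  size≡ : size ν ≡ size μ + t
  size≡ = +-cancelʳ-≡ (part μ b + a) _ _ (begin
    size ν + (part μ b + a)       ≡⟨ Hook-size ν μ h ⟩
    size μ + (part ν a + b)       ≡⟨ cong (_+_ (size μ)) eq ⟨
    size μ + (part μ b + t + a)   ≡⟨ lemma (size μ) (part μ b) t a ⟩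
    (size μ + t) + (part μ b + a) ∎)
    where
    open ≡-Reasoning
    lemma : ∀ x y z w → x + (y + z + w) ≡ (x + z) + (y + w)
    lemma = solve-∀

  Path = Star (Step (Skew ν μ))

  toRowStart : ∀ i d → part μ i + d < part ν i → Path (i , part μ i + d) (i , part μ i)
  toRowStart i zero    _  rewrite +-identityʳ (part μ i) = ε
  toRowStart i (suc d) lt rewrite +-suc (part μ i) d =
    ((m≤n⇒m≤1+n (m≤m+n _ d) , lt) , (m≤m+n _ d , <⇒≤ lt) , left) ◅ toRowStart i d (<⇒≤ lt)

  toStart : ∀ i {j} → Skew ν μ (i , j) → Path (i , j) (i , part μ i)
  toStart i (μi≤j , j<νi) = subst (λ j → Path (i , j) (i , part μ i)) (m+[n∸m]≡n μi≤j)
    (toRowStart i _ (subst (_< part ν i) (sym (m+[n∸m]≡n μi≤j)) j<νi))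

  start : ∀ {i j} → Skew ν μ (i , j) → Skew ν μ (i , part μ i)
  start (μi≤j , j<νi) = ≤-refl , ≤-<-trans μi≤j j<νi

  toFirst : ∀ d {j} → Skew ν μ (a + d , j) → Path (a + d , j) (a , part μ a)
  toFirst zero    s rewrite +-identityʳ a = toStart a s
  toFirst (suc d) s rewrite +-suc a d =
    toStart i+1 s ◅◅ reversePath (toStart i+1 corner) ◅◅ ((corner , corner′ , up) ◅ toFirst d corner′)
    where
    i   = a + d
    i+1 = suc (a + d)
    rows = Hook-rows ν↓ μ↓ h (proj₂ (start s))
    -- By `inside`, the last box of row `suc i` lies right below the first box of row `i`: the one
    -- place where the path can climb.
    corner : Skew ν μ (i+1 , part μ i)
    corner = μ↓ i , ≤-reflexive (sym (Hook.inside h (m≤m+n a d) (proj₂ rows)))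
    corner′ : Skew ν μ (i , part μ i)
    corner′ = ≤-refl , ≤-trans (proj₂ corner) (ν↓ i)

  base : ∀ {i j} → Skew ν μ (i , j) → Path (i , j) (a , part μ a)
  base {i} {j} s = subst (λ i → Path (i , j) (a , part μ a)) eq′
    (toFirst _ (subst (λ i → Skew ν μ (i , j)) (sym eq′) s))
    where eq′ = m+[n∸m]≡n (proj₁ (Hook-rows ν↓ μ↓ h (proj₂ (start s))))

  connected : Connected (Skew ν μ)
  connected _ _ s s′ = base s ◅◅ reversePath (base s′)

-- Beads

-- Position p ≥ 0 stands for the integer p - r of the abacus.
At : ℕ → (ℕ → ℕ) → ℕ → Set
At r f p = ∃ λ j → p + suc j ≡ f j + r

position-unique : ∀ {p p′ j n} → p + suc j ≡ n → p′ + suc j ≡ n → p ≡ p′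
position-unique {p} {p′} {j} e e′ = +-cancelʳ-≡ (suc j) p p′ (trans e (sym e′))

position-< : ∀ {p i j m n} → p + suc i ≡ m → p + suc j ≡ n → m < n → i < j
position-< {p} refl refl lt = ≤-pred (+-cancelˡ-< p _ _ lt)

position-≤ : ∀ {p i j m n} → p + suc i ≡ m → p + suc j ≡ n → m ≤ n → i ≤ j
position-≤ {p} refl refl le = ≤-pred (+-cancelˡ-≤ p _ _ le)

module HookBeads {r a b x y : ℕ} {f g : ℕ → ℕ} (f-anti : Antitone f) (g-anti : Antitone g)
  (h : Hook f g a b) (hx : x + suc a ≡ f a + r) (hy : y + suc b ≡ g b + r) where
  open Hook h

  bead-f⇒g : ∀ {p} → p ≢ x → At r f p → At r g p
  bead-f⇒g {p} p≢x (j , e) with <-cmp j a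
  ... | tri< j<a _ _  = j , trans e (cong (_+ r) (above j<a))
  ... | tri≈ _ refl _ = contradiction (position-unique e hx) p≢x
  ... | tri> _ _ a<j with <-≤-connex b j
  ...   | inj₁ b<j = j , trans e (cong (_+ r) (below b<j))
  bead-f⇒g {p} p≢x (suc j , e) | tri> _ _ a<j | inj₂ j≤b =
    j , suc-injective (trans (sym (+-suc p (suc j)))
                             (trans e (cong (_+ r) (inside (≤-pred a<j) j≤b))))

  bead-g⇒f : ∀ {p} → p ≢ y → At r g p → At r f p
  bead-g⇒f {p} p≢y (j , e) with <-cmp j b
  ... | tri> _ _ b<j  = j , trans e (cong (_+ r) (sym (below b<j)))
  ... | tri≈ _ refl _ = contradiction (position-unique e hy) p≢y
  ... | tri< j<b _ _ with <-≤-connex j a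
  ...   | inj₁ j<a = j , trans e (cong (_+ r) (sym (above j<a)))
  ...   | inj₂ a≤j = suc j , trans (+-suc p (suc j))
                               (trans (cong suc e) (cong (_+ r) (sym (inside a≤j j<b))))

  -- Beads decrease strictly with the row. Rows of `g` before `a` are those of `f` and have beads
  -- beyond `x`; from row `a` on, `g` has shrunk below `f a` and its beads lie before `x`.
  x∉g : ¬ At r g x
  x∉g (j , e) with <-≤-connex j a
  ... | inj₁ j<a = <⇒≱ j<a (position-≤ hx (trans e (cong (_+ r) (sym (above j<a))))
                              (+-monoˡ-≤ r (antitone-≤ f-anti (<⇒≤ j<a))))
  ... | inj₂ a≤j = <⇒≱ (position-< e hx
                      (+-monoˡ-< r (≤-<-trans (antitone-≤ g-anti a≤j) (Hook-start f-anti g-anti h)))) a≤j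

  y∉f : ¬ At r f y
  y∉f (j , e) with <-≤-connex b j
  ... | inj₁ b<j = <⇒≱ b<j (position-≤ (trans e (cong (_+ r) (below b<j))) hy
                              (+-monoˡ-≤ r (antitone-≤ g-anti (<⇒≤ b<j))))
  ... | inj₂ j≤b = <⇒≱ (position-< hy e
                      (+-monoˡ-< r (<-≤-trans end (antitone-≤ f-anti j≤b)))) j≤b

-- Strong induction on rows. If the rows before `i` agree, the bead of row `i` of `f` must occur in
-- `g` in some row `j ≥ i`, because the earlier beads are larger; hence `f i ≤ g i`, and
-- symmetrically. Rows from `r` on have beads at negative positions, invisible to `At`, so that
-- `tail` covers them.
beads-injective : ∀ {r f g} → Antitone f → Antitone g → (∀ {i} → r ≤ i → f i ≡ g i) →
                  (∀ {p} → At r f p → At r g p) → (∀ {p} → At r g p → At r f p) → f ≗ g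
beads-injective {r} f-anti g-anti tail f⇒g g⇒f i = below (suc i) ≤-refl
  where
  one-sided : ∀ {f g} → Antitone f → Antitone g → (∀ {p} → At r f p → At r g p) →
              ∀ {i} → i < r → (∀ {j} → j < i → f j ≡ g j) → f i ≤ g i
  one-sided {f} {g} f-anti g-anti f⇒g {i} i<r eq with f⇒g (i , bead)
    where
    -- The position is a natural number because `i < r`.
    bead : (f i + r ∸ suc i) + suc i ≡ f i + r
    bead = m∸n+n≡m (≤-trans i<r (m≤n+m r (f i)))
  ... | j , e with <-≤-connex j i
  ...   | inj₁ j<i = contradiction
    (position-≤ (m∸n+n≡m (≤-trans i<r (m≤n+m r (f i)))) e
      (+-monoˡ-≤ r (≤-trans (antitone-≤ f-anti (<⇒≤ j<i)) (≤-reflexive (eq j<i)))))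
    (<⇒≱ j<i)
  ...   | inj₂ i≤j = +-cancelʳ-≤ r _ _ (begin
    f i + r                    ≡⟨ m∸n+n≡m (≤-trans i<r (m≤n+m r (f i))) ⟨
    (f i + r ∸ suc i) + suc i  ≤⟨ +-monoʳ-≤ _ (s≤s i≤j) ⟩
    (f i + r ∸ suc i) + suc j  ≡⟨ e ⟩
    g j + r                    ≤⟨ +-monoˡ-≤ r (antitone-≤ g-anti i≤j) ⟩
    g i + r                    ∎)
    where open ≤-Reasoning

  below : ∀ n {i} → i < n → _ ≡ _
  below (suc n) {i} i<1+n with <-≤-connex i r
  ... | inj₂ r≤i = tail r≤i
  ... | inj₁ i<r = ≤-antisym
    (one-sided f-anti g-anti f⇒g i<r (λ j<i → below n (<-≤-trans j<i (≤-pred i<1+n))))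
    (one-sided g-anti f-anti g⇒f i<r (λ j<i → sym (below n (<-≤-trans j<i (≤-pred i<1+n)))))

-- Sliding one bead by t positions

splice : ℕ → (ℕ → ℕ) → (ℕ → ℕ) → ℕ → ℕ
splice zero    f g i       = g i
splice (suc n) f g zero    = f 0
splice (suc n) f g (suc i) = splice n (f ∘ suc) (g ∘ suc) i

splice-< : ∀ n {f g i} → i < n → splice n f g i ≡ f i
splice-< (suc n) {i = zero}  _         = refl
splice-< (suc n) {i = suc i} (s≤s i<n) = splice-< n i<n

splice-≥ : ∀ n {f g i} → n ≤ i → splice n f g i ≡ g i
splice-≥ zero    _         = refl
splice-≥ (suc n) (s≤s n≤i) = splice-≥ n n≤i

splice-antitone : ∀ n {f g} → (∀ {i} → suc i < n → f (suc i) ≤ f i) →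
                  (∀ {i} → n ≤ i → g (suc i) ≤ g i) →
                  (∀ {i} → suc i ≡ n → g n ≤ f i) → Antitone (splice n f g)
splice-antitone n {f} {g} f-anti g-anti join i with <-cmp (suc i) n
... | tri< i+1<n _ _ rewrite splice-< n {f} {g} i+1<n | splice-< n {f} {g} (<⇒≤ i+1<n) = f-anti i+1<n
... | tri≈ _ refl _  rewrite splice-≥ n {f} {g} (≤-refl {n}) | splice-< n {f} {g} ≤-refl = join refl
... | tri> _ _ n<i+1 rewrite splice-≥ n {f} {g} (<⇒≤ n<i+1) | splice-≥ n {f} {g} (≤-pred n<i+1) =
  g-anti (≤-pred n<i+1)

module Slide (r y t : ℕ) (1≤t : 1 ≤ t) where

  -- The beads strictly between `y` and `y + t` occupy rows `suc a` to `b` of `f`. Each is handed to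
  -- the row before it, which costs one box of the part, and row `b` receives the bead at `y`.
  slideDown : ∀ {f} → Antitone f → f r ≡ 0 → At r f (y + t) → ¬ At r f y →
              ∃ λ g → ∃₂ λ a b → Antitone g × Hook f g a b × g b + t + a ≡ f a + b
  slideDown {f} f-anti fr≡0 (a , hx) y∉f = g , a , b , g-anti , hook , +-cancelʳ-≡ r _ _ shift
    where
    Above : ℕ → Set
    Above i = y + suc i < f i + r

    above-a : Above a
    above-a = subst (y + suc a <_) hx (+-monoˡ-< (suc a) (m<m+n y 1≤t))

    -- An empty row from `r` on has its bead at a negative position.
    bound : ∀ {i} → r ≤ i → ¬ Above i
    bound {i} r≤i lt rewrite n≤0⇒n≡0 (subst (f i ≤_) fr≡0 (antitone-≤ f-anti r≤i)) =
      <⇒≱ lt (≤-trans (m≤n⇒m≤1+n r≤i) (m≤n+m (suc i) y))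

    last = greatest (λ i → y + suc i <? f i + r) r above-a bound
    b    = proj₁ last
    a≤b  = proj₁ (proj₂ last)

    -- Row `suc b` is not above `y`, and `y` carries no bead, so its bead is strictly before `y`.
    -- This gains the unit that makes row `b` of `g` at least as long as the next row.
    y-after : f (suc b) + r ≤ y + suc b
    y-after = ≤-pred (subst (f (suc b) + r <_) (+-suc y (suc b))
      (≤∧≢⇒< (≮⇒≥ (proj₂ (proj₂ (proj₂ last)) ≤-refl)) λ e → y∉f (suc b , sym e)))

    -- The part that puts the bead of row `b` at `y`; `y-after` makes the subtraction exact.
    c = y + suc b ∸ r

    c+r : c + r ≡ y + suc b
    c+r = m∸n+n≡m (≤-trans (m≤n+m r _) y-after)

    f≤c : f (suc b) ≤ c
    f≤c = +-cancelʳ-≤ r _ _ (subst (f (suc b) + r ≤_) (sym c+r) y-after)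

    c<f : c < f b
    c<f = +-cancelʳ-< r _ _ (subst (_< f b + r) (sym c+r) (proj₁ (proj₂ (proj₂ last))))

    g₂ = splice (suc b) (λ _ → c) f
    g₁ = splice b (λ i → pred (f (suc i))) g₂
    g  = splice a f g₁

    g₁b : g₁ b ≡ c
    g₁b = trans (splice-≥ b ≤-refl) (splice-< (suc b) ≤-refl)

    g-end : g b ≡ c
    g-end = trans (splice-≥ a a≤b) g₁b

    g₁-anti : Antitone g₁
    g₁-anti = splice-antitone b (λ _ → pred-mono-≤ (f-anti _))
      (λ {i} _ → splice-antitone (suc b) (λ _ → ≤-refl) (λ _ → f-anti _) (λ _ → f≤c) i)
      λ i+1≡b → subst (λ j → g₂ b ≤ pred (f j)) (sym i+1≡b)
        (≤-trans (≤-reflexive (splice-< (suc b) {g = f} ≤-refl)) (pred-mono-≤ c<f))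

    g₁≤f : g₁ a ≤ f a
    g₁≤f with m≤n⇒m<n∨m≡n a≤b
    ... | inj₁ a<b  = ≤-trans (≤-reflexive (splice-< b a<b)) (≤-trans pred[n]≤n (f-anti a))
    ... | inj₂ a≡b  = subst (λ i → g₁ i ≤ f i) (sym a≡b) (subst (_≤ f b) (sym g₁b) (<⇒≤ c<f))

    g-anti : Antitone g
    g-anti = splice-antitone a (λ _ → f-anti _) (λ {i} _ → g₁-anti i)
      λ { {i} refl → ≤-trans g₁≤f (f-anti i) }

    hook : Hook f g a b
    hook = record
      { a≤b    = a≤b
      ; above  = λ i<a → sym (splice-< a i<a)
      ; inside = λ {i} a≤i i<b → sym (trans
          (cong suc (trans (splice-≥ a a≤i) (splice-< b i<b)))
          (suc-pred (f (suc i))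
            {{>-nonZero (≤-<-trans z≤n (<-≤-trans c<f (antitone-≤ f-anti i<b)))}}))
      ; end    = subst (_< f b) (sym g-end) c<f
      ; below  = λ {i} b<i → sym (trans (splice-≥ a (≤-trans a≤b (<⇒≤ b<i)))
                   (trans (splice-≥ b (<⇒≤ b<i)) (splice-≥ (suc b) b<i)))
      }

    open ≡-Reasoning
    shift : g b + t + a + r ≡ f a + b + r
    shift = begin
      g b + t + a + r        ≡⟨ cong (λ z → z + t + a + r) g-end ⟩
      c + t + a + r          ≡⟨ lemma₁ c t a r ⟩
      (c + r) + (t + a)      ≡⟨ cong (_+ (t + a)) c+r ⟩
      y + suc b + (t + a)    ≡⟨ lemma₂ y b t a ⟩
      (y + t + suc a) + b    ≡⟨ cong (_+ b) hx ⟩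
      f a + r + b            ≡⟨ lemma₃ (f a) r b ⟩
      f a + b + r            ∎
      where
      lemma₁ : ∀ c t a r → c + t + a + r ≡ (c + r) + (t + a)
      lemma₁ = solve-∀
      lemma₂ : ∀ y b t a → y + suc b + (t + a) ≡ (y + t + suc a) + b
      lemma₂ = solve-∀
      lemma₃ : ∀ f r b → f + r + b ≡ f + b + r
      lemma₃ = solve-∀

  -- The mirror image: `a` is the first row of `g` whose bead lies before `y + t`. As `y + t` is
  -- free, the earlier beads lie strictly beyond it, which leaves room for a new row `a`; rows `a`
  -- to `pred b` of `g` are pushed down by one row and gain a box each.
  slideUp : ∀ {g} → Antitone g → ¬ At r g (y + t) → ((b , _) : At r g y) →
            ∃₂ λ f a → Antitone f × Hook f g a b × y + t + suc a ≡ f a + r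
  slideUp {g} g-anti x∉g (b , hy) = f , a , f-anti , hook , trans (sym c+r) (cong (_+ r) (sym f-start))
    where
    x = y + t
    Under : ℕ → Set
    Under i = g i + r < x + suc i

    under-b : Under b
    under-b = subst (_< x + suc b) hy (+-monoˡ-< (suc b) (m<m+n y 1≤t))

    first = least (λ i → g i + r <? x + suc i) under-b
    a     = proj₁ first
    a≤b   = proj₁ (proj₂ first)

    c = x + suc a ∸ r

    c+r : c + r ≡ x + suc a
    c+r = m∸n+n≡m (≤-trans (m≤n+m r (g a)) (<⇒≤ (proj₁ (proj₂ (proj₂ first)))))

    g<c : g a < c
    g<c = +-cancelʳ-< r _ _ (subst (g a + r <_) (sym c+r) (proj₁ (proj₂ (proj₂ first))))

    c≤g : ∀ {i} → suc i ≡ a → c ≤ g i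
    c≤g {i} i+1≡a = +-cancelʳ-≤ r _ _ (subst (_≤ g i + r) (sym (trans c+r x+a))
      (≤∧≢⇒< (≮⇒≥ (proj₂ (proj₂ (proj₂ first)) (≤-reflexive i+1≡a))) λ e → x∉g (i , e)))
      where
      x+a : x + suc a ≡ suc (x + suc i)
      x+a = trans (cong (λ j → x + suc j) (sym i+1≡a)) (+-suc x (suc i))

    -- `f` reads these values from index `suc a` on; `pred 0` being 0 keeps the function antitone at
    -- its first index as well.
    lowered = λ i → suc (g (pred i))
    f₂ = splice (suc b) lowered g
    f₁ = splice (suc a) (λ _ → c) f₂
    f  = splice a g f₁

    f₁a : f₁ a ≡ c
    f₁a = splice-< (suc a) ≤-refl

    f-start : f a ≡ c
    f-start = trans (splice-≥ a ≤-refl) f₁a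

    f₂-anti : ∀ {i} → suc a ≤ i → f₂ (suc i) ≤ f₂ i
    f₂-anti {suc i} _ = splice-antitone (suc b) {lowered} {g}
      (λ { {zero} _ → ≤-refl ; {suc j} _ → s≤s (g-anti j) }) (λ _ → g-anti _)
      (λ { {zero} e → subst (λ j → g j ≤ suc (g 0)) e (≤-trans (g-anti 0) (n≤1+n _))
         ; {suc j} e → subst (λ k → g k ≤ suc (g j)) e
             (≤-trans (g-anti (suc j)) (≤-trans (g-anti j) (n≤1+n _))) }) (suc i)

    f₂≤c : f₂ (suc a) ≤ c
    f₂≤c with m≤n⇒m<n∨m≡n a≤b
    ... | inj₁ a<b = ≤-trans (≤-reflexive (splice-< (suc b) {lowered} {g} (s≤s a<b))) g<c
    ... | inj₂ a≡b = ≤-trans (≤-reflexive (splice-≥ (suc b) {lowered} {g} (s≤s (≤-reflexive (sym a≡b)))))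
                             (≤-trans (g-anti a) (<⇒≤ g<c))

    f-anti : Antitone f
    f-anti = splice-antitone a (λ _ → g-anti _)
      (λ {i} _ → splice-antitone (suc a) (λ _ → ≤-refl) f₂-anti (λ _ → f₂≤c) i)
      λ i+1≡a → subst (_≤ _) (sym f₁a) (c≤g i+1≡a)

    end : g b < f b
    end with m≤n⇒m<n∨m≡n a≤b
    ... | inj₂ a≡b = subst (λ i → g i < f i) a≡b (subst (g a <_) (sym f-start) g<c)
    ... | inj₁ a<b = subst (g b <_) (sym (trans (splice-≥ a a≤b)
                       (trans (splice-≥ (suc a) a<b) (splice-< (suc b) {lowered} {g} ≤-refl))))
                       (s≤s (antitone-≤ g-anti pred[n]≤n))

    hook : Hook f g a b
    hook = record
      { a≤b    = a≤b
      ; above  = splice-< a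
      ; inside = λ a≤i i<b → trans (splice-≥ a (m≤n⇒m≤1+n a≤i))
                   (trans (splice-≥ (suc a) {λ _ → c} {f₂} (s≤s a≤i)) (splice-< (suc b) {lowered} {g} (s≤s i<b)))
      ; end    = end
      ; below  = λ b<i → trans (splice-≥ a (≤-trans a≤b (<⇒≤ b<i)))
                   (trans (splice-≥ (suc a) (≤-<-trans a≤b b<i)) (splice-≥ (suc b) {lowered} {g} b<i))
      }

-- Words and moves

-- The index is the place of the exchanged pair, so that a move can be undone from its target and
-- index alone.
data Move : ℕ → List Bool → List Bool → Set where
  here  : ∀ {w} → Move 0 (false ∷ true ∷ w) (true ∷ false ∷ w)
  there : ∀ {k c u v} → Move k u v → Move (suc k) (c ∷ u) (c ∷ v)

-- Counts the pairs of a 0 and a later 1.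
inv : List Bool → ℕ
inv []          = 0
inv (true  ∷ v) = inv v
inv (false ∷ v) = ones v + inv v

Move-length : ∀ {k u v} → Move k u v → length u ≡ length v
Move-length here      = refl
Move-length (there m) = cong suc (Move-length m)

Move-ones : ∀ {k u v} → Move k u v → ones u ≡ ones v
Move-ones here                  = refl
Move-ones (there {c = true}  m) = cong suc (Move-ones m)
Move-ones (there {c = false} m) = Move-ones m

Move-inv : ∀ {k u v} → Move k u v → inv u ≡ suc (inv v)
Move-inv here                            = refl
Move-inv (there {c = true}          m)   = Move-inv m
Move-inv (there {c = false} {v = v} m) rewrite Move-ones m | Move-inv m = +-suc (ones v) (inv v)

Move-injective : ∀ {k u v w} → Move k u w → Move k v w → u ≡ v
Move-injective here      here       = refl
Move-injective (there m) (there m′) = cong (_ ∷_) (Move-injective m m′)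

Move-exists : ∀ u → inv u ≢ 0 → ∃₂ λ k v → Move k u v
Move-exists []                  nz = contradiction refl nz
Move-exists (true ∷ u)          nz with Move-exists u nz
... | k , v , m = suc k , true ∷ v , there m
Move-exists (false ∷ [])        nz = contradiction refl nz
Move-exists (false ∷ true ∷ w)  nz = 0 , _ , here
-- Some inversion survives the removal of the first letter: otherwise `ones w` would be 0 and the
-- whole word would have none.
Move-exists (false ∷ false ∷ w) nz
  with Move-exists (false ∷ w) (λ z → nz (cong₂ _+_ (m+n≡0⇒m≡0 (ones w) z) z))
... | k , v , m = suc k , false ∷ v , there m

-- A word without inversions is a block of 1's followed by a block of 0's; a leading 0 therefore
-- forces `ones` to be 0.
inv≡0-unique : ∀ {u v} → inv u ≡ 0 → inv v ≡ 0 → length u ≡ length v → ones u ≡ ones v → u ≡ v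
inv≡0-unique {[]}        {[]}        _ _ _  _  = refl
inv≡0-unique {true ∷ u}  {true ∷ v}  p q el eo =
  cong (true ∷_) (inv≡0-unique p q (suc-injective el) (suc-injective eo))
inv≡0-unique {false ∷ u} {false ∷ v} p q el eo = cong (false ∷_)
  (inv≡0-unique (m+n≡0⇒n≡0 (ones u) p) (m+n≡0⇒n≡0 (ones v) q) (suc-injective el) eo)
inv≡0-unique {true ∷ u}  {false ∷ v} p q el eo =
  contradiction (trans eo (m+n≡0⇒m≡0 (ones v) q)) λ ()
inv≡0-unique {false ∷ u} {true ∷ v}  p q el eo =
  contradiction (trans (sym eo) (m+n≡0⇒m≡0 (ones u) p)) λ ()

data Moves : ℕ → ℕ → List (List Bool) → List (List Bool) → Set where
  here  : ∀ {k u v ws} → Move k u v → Moves 0 k (u ∷ ws) (v ∷ ws)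
  there : ∀ {i k w us vs} → Moves i k us vs → Moves (suc i) k (w ∷ us) (w ∷ vs)

Inv : List (List Bool) → ℕ
Inv us = sum (map inv us)

Moves-lengths : ∀ {i k us vs} → Moves i k us vs → map length us ≡ map length vs
Moves-lengths (here m)  = cong (_∷ _) (Move-length m)
Moves-lengths (there m) = cong (_ ∷_) (Moves-lengths m)

Moves-ones : ∀ {i k us vs} → Moves i k us vs → map ones us ≡ map ones vs
Moves-ones (here m)  = cong (_∷ _) (Move-ones m)
Moves-ones (there m) = cong (_ ∷_) (Moves-ones m)

Moves-Inv : ∀ {i k us vs} → Moves i k us vs → Inv us ≡ suc (Inv vs)
Moves-Inv (here m)          = cong (_+ _) (Move-inv m)
Moves-Inv (there {w = w} m) = trans (cong (_+_ (inv w)) (Moves-Inv m)) (+-suc (inv w) _)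

Moves-injective : ∀ {i k us vs ws} → Moves i k us ws → Moves i k vs ws → us ≡ vs
Moves-injective (here m)  (here m′)  = cong (_∷ _) (Move-injective m m′)
Moves-injective (there m) (there m′) = cong (_ ∷_) (Moves-injective m m′)

Moves-exists : ∀ us → Inv us ≢ 0 → ∃₂ λ i k → ∃ λ vs → Moves i k us vs
Moves-exists []       nz = contradiction refl nz
Moves-exists (u ∷ us) nz with inv u ≟ 0
... | no nz-u with Move-exists u nz-u
...   | k , v , m = 0 , k , v ∷ us , here m
Moves-exists (u ∷ us) nz | yes z-u with Moves-exists us (λ z → nz (cong₂ _+_ z-u z))
...   | i , k , vs , m = suc i , k , u ∷ vs , there m

Inv≡0-unique : ∀ {us vs} → Inv us ≡ 0 → Inv vs ≡ 0 → map length us ≡ map length vs →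
               map ones us ≡ map ones vs → us ≡ vs
Inv≡0-unique {[]}     {[]}     _ _ _  _  = refl
Inv≡0-unique {[]}     {_ ∷ _}  _ _ () _
Inv≡0-unique {_ ∷ _}  {[]}     _ _ () _
Inv≡0-unique {u ∷ us} {v ∷ vs} p q el eo with ∷-injective el | ∷-injective eo
... | el₁ , el₂ | eo₁ , eo₂ = cong₂ _∷_
  (inv≡0-unique (m+n≡0⇒m≡0 (inv u) p) (m+n≡0⇒m≡0 (inv v) q) el₁ eo₁)
  (Inv≡0-unique (m+n≡0⇒n≡0 (inv u) p) (m+n≡0⇒n≡0 (inv v) q) el₂ eo₂)

-- Moves on words tabulated from functions

module _ {A : Set} where

  applyUpTo-congˡ : ∀ n {f g : ℕ → A} → (∀ {i} → i < n → f i ≡ g i) →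
                    applyUpTo f n ≡ applyUpTo g n
  applyUpTo-congˡ zero    _  = refl
  applyUpTo-congˡ (suc n) eq = cong₂ _∷_ (eq z<s) (applyUpTo-congˡ n (eq ∘ s<s))

  applyUpTo-injective : ∀ n {f g : ℕ → A} → applyUpTo f n ≡ applyUpTo g n →
                        ∀ {i} → i < n → f i ≡ g i
  applyUpTo-injective (suc n) eq {zero}  _         = proj₁ (∷-injective eq)
  applyUpTo-injective (suc n) eq {suc i} (s≤s i<n) = applyUpTo-injective n (proj₂ (∷-injective eq)) i<n

Move-applyUpTo : ∀ n k {f g} → suc k < n → f k ≡ false → f (suc k) ≡ true → g k ≡ true →
                 g (suc k) ≡ false → (∀ {j} → j ≢ k → j ≢ suc k → f j ≡ g j) →
                 Move k (applyUpTo f n) (applyUpTo g n)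
Move-applyUpTo (suc (suc n)) zero {f} {g} _ f0 f1 g0 g1 eq
  rewrite f0 | f1 | g0 | g1 | applyUpTo-congˡ n {f ∘ suc ∘ suc} {g ∘ suc ∘ suc} (λ _ → eq (λ ()) (λ ())) = here
Move-applyUpTo (suc n) (suc k) (s≤s k<n) f0 f1 g0 g1 eq rewrite eq {0} (λ ()) (λ ()) =
  there (Move-applyUpTo n k k<n f0 f1 g0 g1 λ ne ne′ → eq (ne ∘ suc-injective) (ne′ ∘ suc-injective))

Move-source : ∀ {f k u v} n → Move k u v → u ≡ applyUpTo f n →
              suc k < n × f k ≡ false × f (suc k) ≡ true
Move-source (suc (suc n)) here eq with ∷-injective eq
... | f0 , eq′ = s≤s z<s , sym f0 , sym (proj₁ (∷-injective eq′))
Move-source (suc n) (there m) eq with Move-source n m (proj₂ (∷-injective eq))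
... | k<n , f0 , f1 = s≤s k<n , f0 , f1
Move-source zero          here      ()
Move-source (suc zero)    here      ()
Move-source zero          (there _) ()

Move-target : ∀ {g k u v} n → Move k u v → v ≡ applyUpTo g n →
              suc k < n × g k ≡ true × g (suc k) ≡ false
Move-target (suc (suc n)) here eq with ∷-injective eq
... | g0 , eq′ = s≤s z<s , sym g0 , sym (proj₁ (∷-injective eq′))
Move-target (suc n) (there m) eq with Move-target n m (proj₂ (∷-injective eq))
... | k<n , g0 , g1 = s≤s k<n , g0 , g1
Move-target zero          here      ()
Move-target (suc zero)    here      ()
Move-target zero          (there _) ()

Moves-applyUpTo : ∀ n i {k F G} → i < n → Move k (F i) (G i) → (∀ {j} → j < n → j ≢ i → F j ≡ G j) →
                  Moves i k (applyUpTo F n) (applyUpTo G n)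
Moves-applyUpTo (suc n) zero {F = F} {G} _ m eq
  rewrite applyUpTo-congˡ n {F ∘ suc} {G ∘ suc} (λ j<n → eq (s<s j<n) λ ()) = here m
Moves-applyUpTo (suc n) (suc i) (s≤s i<n) m eq rewrite eq {0} z<s (λ ()) =
  there (Moves-applyUpTo n i i<n m λ j<n ne → eq (s<s j<n) (ne ∘ suc-injective))

Moves-source : ∀ {F i k us vs} n → Moves i k us vs → us ≡ applyUpTo F n →
               i < n × ∃ λ v → Move k (F i) v
Moves-source (suc n) (here m)  refl = z<s , _ , m
Moves-source (suc n) (there m) eq with Moves-source n m (proj₂ (∷-injective eq))
... | i<n , v , m′ = s≤s i<n , v , m′
Moves-source zero (here _)  ()
Moves-source zero (there _) ()

Moves-target : ∀ {G i k us vs} n → Moves i k us vs → vs ≡ applyUpTo G n →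
               i < n × ∃ λ u → Move k u (G i)
Moves-target (suc n) (here m)  refl = z<s , _ , m
Moves-target (suc n) (there m) eq with Moves-target n m (proj₂ (∷-injective eq))
... | i<n , u , m′ = s≤s i<n , u , m′
Moves-target zero (here _)  ()
Moves-target zero (there _) ()

-- The words of a partition

Bead⇔position : ∀ ν r p j → Bead ν (ℤ.- + r ℤ.+ + p) j ⇔ p + suc j ≡ part ν j + r
Bead⇔position ν r p j = mk⇔ to from
  where
  open ≡-Reasoning
  l₁ : ∀ r p j → p ℤ.+ j ≡ (ℤ.- r ℤ.+ p) ℤ.+ (r ℤ.+ j)
  l₁ = ℤ-Solver.solve-∀
  l₂ : ∀ n r j → (n ℤ.+ ℤ.- j) ℤ.+ (r ℤ.+ j) ≡ n ℤ.+ r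
  l₂ = ℤ-Solver.solve-∀
  l₃ : ∀ r p j → ℤ.- r ℤ.+ p ≡ (p ℤ.+ j) ℤ.+ (ℤ.- r ℤ.+ ℤ.- j)
  l₃ = ℤ-Solver.solve-∀
  l₄ : ∀ n r j → (n ℤ.+ r) ℤ.+ (ℤ.- r ℤ.+ ℤ.- j) ≡ n ℤ.+ ℤ.- j
  l₄ = ℤ-Solver.solve-∀

  to : Bead ν (ℤ.- + r ℤ.+ + p) j → p + suc j ≡ part ν j + r
  to e = ℤ.+-injective (begin
    + p ℤ.+ + suc j                                   ≡⟨ l₁ (+ r) (+ p) (+ suc j) ⟩
    (ℤ.- + r ℤ.+ + p) ℤ.+ (+ r ℤ.+ + suc j)           ≡⟨ cong (ℤ._+ (+ r ℤ.+ + suc j)) e ⟩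
    (+ part ν j ℤ.- + suc j) ℤ.+ (+ r ℤ.+ + suc j)    ≡⟨ l₂ (+ part ν j) (+ r) (+ suc j) ⟩
    + part ν j ℤ.+ + r                                ∎)

  from : p + suc j ≡ part ν j + r → Bead ν (ℤ.- + r ℤ.+ + p) j
  from e = begin
    ℤ.- + r ℤ.+ + p                                        ≡⟨ l₃ (+ r) (+ p) (+ suc j) ⟩
    (+ p ℤ.+ + suc j) ℤ.+ (ℤ.- + r ℤ.+ ℤ.- + suc j)        ≡⟨ cong (λ n → + n ℤ.+ (ℤ.- + r ℤ.+ ℤ.- + suc j)) e ⟩
    (+ part ν j ℤ.+ + r) ℤ.+ (ℤ.- + r ℤ.+ ℤ.- + suc j)     ≡⟨ l₄ (+ part ν j) (+ r) (+ suc j) ⟩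
    + part ν j ℤ.- + suc j                                 ∎

isYes-true : ∀ {a} {A : Set a} (d : Dec A) → A → ⌊ d ⌋ ≡ true
isYes-true (yes _) _ = refl
isYes-true (no ¬a) a = contradiction a ¬a

isYes-false : ∀ {a} {A : Set a} (d : Dec A) → ¬ A → ⌊ d ⌋ ≡ false
isYes-false (yes a) ¬a = contradiction a ¬a
isYes-false (no _)  _  = refl

isYes-true⁻ : ∀ {a} {A : Set a} (d : Dec A) → ⌊ d ⌋ ≡ true → A
isYes-true⁻ (yes a) _ = a

isYes-false⁻ : ∀ {a} {A : Set a} (d : Dec A) → ⌊ d ⌋ ≡ false → ¬ A
isYes-false⁻ (no ¬a) _ = ¬a

isYes-cong : ∀ {a b} {A : Set a} {B : Set b} (d : Dec A) (e : Dec B) →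
             (A → B) → (B → A) → ⌊ d ⌋ ≡ ⌊ e ⌋
isYes-cong (yes a) e f g = sym (isYes-true e (f a))
isYes-cong (no ¬a) e f g = sym (isYes-false e (¬a ∘ g))

-- Runners: positions by residue and quotient modulo t

module Runners (r s t : ℕ) .{{_ : NonZero t}} where
  open Nat using (_*_)

  at? : ∀ ν p → Dec (At r (part ν) p)
  at? ν p = map′ (λ (j , e) → j , Equivalence.to (Bead⇔position ν r p j) e)
                 (λ (j , e) → j , Equivalence.from (Bead⇔position ν r p j) e)
                 (bead? ν (ℤ.- + r ℤ.+ + p))

  opaque
    letter : Partition → ℕ → ℕ → Bool
    letter ν i k = abacus ν (ℤ.- + r ℤ.+ + i ℤ.+ + (t * k))

    word≡letters : ∀ ν i → word r s t ν i ≡ applyUpTo (letter ν i) (wordLength r s t i)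
    word≡letters ν i = refl

    letter≡at? : ∀ ν i k → letter ν i k ≡ ⌊ at? ν (i + t * k) ⌋
    letter≡at? ν i k rewrite ℤ.+-assoc (ℤ.- + r) (+ i) (+ (t * k)) =
      isYes-cong (bead? ν (ℤ.- + r ℤ.+ + (i + t * k))) (at? ν (i + t * k))
        (λ (j , e) → j , Equivalence.to (Bead⇔position ν r _ j) e)
        (λ (j , e) → j , Equivalence.from (Bead⇔position ν r _ j) e)

  module _ {ν : Partition} {i k : ℕ} where
    private
      p = i + t * k

    letter-true : At r (part ν) p → letter ν i k ≡ true
    letter-true at = trans (letter≡at? ν i k) (isYes-true (at? ν p) at)

    letter-false : ¬ At r (part ν) p → letter ν i k ≡ false
    letter-false ¬at = trans (letter≡at? ν i k) (isYes-false (at? ν p) ¬at)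

    letter-true⁻ : letter ν i k ≡ true → At r (part ν) p
    letter-true⁻ eq = isYes-true⁻ (at? ν p) (trans (sym (letter≡at? ν i k)) eq)

    letter-false⁻ : letter ν i k ≡ false → ¬ At r (part ν) p
    letter-false⁻ eq = isYes-false⁻ (at? ν p) (trans (sym (letter≡at? ν i k)) eq)

  letter-cong : ∀ {ν μ i k} → (At r (part ν) (i + t * k) → At r (part μ) (i + t * k)) →
                (At r (part μ) (i + t * k) → At r (part ν) (i + t * k)) →
                letter ν i k ≡ letter μ i k
  letter-cong {ν} {μ} {i} {k} f g = trans (letter≡at? ν i k)
    (trans (isYes-cong (at? ν _) (at? μ _) f g) (sym (letter≡at? μ i k)))

  W : Partition → List (List Bool)
  W ν = applyUpTo (λ i → applyUpTo (letter ν i) (wordLength r s t i)) t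

  position-%/ : ∀ {i k} → i < t → (i + t * k) % t ≡ i × (i + t * k) / t ≡ k
  position-%/ {i} {k} i<t = i≡ , k≡
    where
    i≡ : (i + t * k) % t ≡ i
    i≡ = trans (cong (λ z → (i + z) % t) (*-comm t k)) (trans ([m+kn]%n≡m%n i k t) (m<n⇒m%n≡m i<t))
    k≡ : (i + t * k) / t ≡ k
    k≡ = *-cancelʳ-≡ _ k t (+-cancelˡ-≡ i _ _ (begin
      i + (i + t * k) / t * t               ≡⟨ cong (_+ (i + t * k) / t * t) i≡ ⟨
      (i + t * k) % t + (i + t * k) / t * t ≡⟨ m≡m%n+[m/n]*n (i + t * k) t ⟨
      i + t * k                             ≡⟨ cong (_+_ i) (*-comm t k) ⟩
      i + k * t                             ∎))
      where open ≡-Reasoning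

  position-injective : ∀ {i i′ k k′} → i < t → i′ < t → i + t * k ≡ i′ + t * k′ → i ≡ i′ × k ≡ k′
  position-injective i<t i′<t eq with position-%/ i<t | position-%/ i′<t
  ... | i≡ , k≡ | i′≡ , k′≡ =
    trans (sym i≡) (trans (cong (_% t) eq) i′≡) , trans (sym k≡) (trans (cong (_/ t) eq) k′≡)

  module _ {i k : ℕ} (i<t : i < t) where
    private
      M = r + s + t ∸ 1 ∸ i

      i+M : suc (i + M) ≡ r + s + t
      i+M = begin
        suc (i + M)           ≡⟨ cong suc (m+[n∸m]≡n (∸-monoˡ-≤ 1 (≤-trans i<t (m≤n+m t (r + s))))) ⟩
        suc (r + s + t ∸ 1)   ≡⟨ m+[n∸m]≡n (≤-trans (≤-trans (s≤s z≤n) i<t) (m≤n+m t (r + s))) ⟩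
        r + s + t             ∎
        where open ≡-Reasoning

      shift : suc (i + suc k * t) ≡ suc (i + t * k) + t
      shift = lemma i k t
        where
        lemma : ∀ i k t → suc (i + suc k * t) ≡ suc (i + t * k) + t
        lemma = solve-∀

    -- `wordLength` is `(r + s - i) / t` rounded up, that is, the number of positions below `r + s`
    -- on runner `i`. Since `i < t`, its truncated subtractions are exact.
    <wordLength⇒position< : k < wordLength r s t i → i + t * k < r + s
    <wordLength⇒position< k<n = +-cancelʳ-≤ t _ _ (begin
      suc (i + t * k) + t      ≡⟨ shift ⟨
      suc (i + suc k * t)      ≤⟨ s≤s (+-monoʳ-≤ i (*-monoˡ-≤ t k<n)) ⟩
      suc (i + M / t * t)      ≤⟨ s≤s (+-monoʳ-≤ i (m/n*n≤m M t)) ⟩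
      suc (i + M)              ≡⟨ i+M ⟩
      r + s + t                ∎)
      where open ≤-Reasoning

    position<⇒<wordLength : i + t * k < r + s → k < wordLength r s t i
    position<⇒<wordLength p<N = subst (_≤ M / t) (m*n/n≡m (suc k) t)
      (/-monoˡ-≤ t (+-cancelˡ-≤ i _ _ (≤-pred (begin
        suc (i + suc k * t)    ≡⟨ shift ⟩
        suc (i + t * k) + t    ≤⟨ +-monoˡ-≤ t p<N ⟩
        r + s + t              ≡⟨ i+M ⟨
        suc (i + M)            ∎))))
      where open ≤-Reasoning

  part≡0 : ∀ {ν} → ν ∈𝒫[ r , s ] → ∀ {i} → r ≤ i → part ν i ≡ 0
  part≡0 {ν} (l≤r , _) r≤i = nth-beyond (parts ν) (≤-trans l≤r r≤i)

  At-row : ∀ {ν} → ν ∈𝒫[ r , s ] → ∀ {p} → ((j , _) : At r (part ν) p) → j < r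
  At-row {ν} ν∈ {p} (j , e) with <-≤-connex j r
  ... | inj₁ j<r = j<r
  ... | inj₂ r≤j rewrite part≡0 {ν} ν∈ r≤j =
    contradiction (≤-trans (s≤s r≤j) (m≤n+m (suc j) p)) (<⇒≱ (s≤s (≤-reflexive e)))

  At-bound : ∀ {ν} → ν ∈𝒫[ r , s ] → ∀ {p} → At r (part ν) p → p < r + s
  At-bound {ν} (_ , ν₀≤s) {p} (j , e) = begin
    suc p          ≤⟨ m<m+n p z<s ⟩
    p + suc j      ≡⟨ e ⟩
    part ν j + r   ≤⟨ +-monoˡ-≤ r (≤-trans (antitone-≤ (part-antitone ν) z≤n) ν₀≤s) ⟩
    s + r          ≡⟨ +-comm s r ⟩
    r + s          ∎
    where open ≤-Reasoning

  -- Inside the box all beads at nonnegative positions lie below `r + s`, so the words record each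
  -- of them.
  W-injective : ∀ {ν ν′} → ν ∈𝒫[ r , s ] → ν′ ∈𝒫[ r , s ] → W ν ≡ W ν′ → ν ≡ ν′
  W-injective {ν} {ν′} ν∈ ν′∈ eq = part-injective (beads-injective {r}
    (part-antitone ν) (part-antitone ν′)
    (λ r≤i → trans (part≡0 {ν} ν∈ r≤i) (sym (part≡0 {ν′} ν′∈ r≤i)))
    (transfer {ν} {ν′} ν∈ eq) (transfer {ν′} {ν} ν′∈ (sym eq)))
    where
    transfer : ∀ {ν ν′} → ν ∈𝒫[ r , s ] → W ν ≡ W ν′ → ∀ {p} → At r (part ν) p → At r (part ν′) p
    transfer {ν} {ν′} ν∈ eq {p} at = subst (At r (part ν′)) (sym p≡) (letter-true⁻ {ν′} {i} {k}
      (trans (sym letters) (letter-true {ν} {i} {k} (subst (At r (part ν)) p≡ at))))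
      where
      i = p % t
      k = p / t
      p≡ : p ≡ i + t * k
      p≡ = trans (m≡m%n+[m/n]*n p t) (cong (_+_ i) (*-comm k t))
      letters : letter ν i k ≡ letter ν′ i k
      letters = applyUpTo-injective (wordLength r s t i)
        (applyUpTo-injective t eq (m%n<n p t))
        (position<⇒<wordLength (m%n<n p t) (subst (_< r + s) p≡ (At-bound {ν} ν∈ at)))

  hook⇒moves : ∀ {ν μ a b i k} → Hook (part ν) (part μ) a b → i < t →
               i + t * suc k + suc a ≡ part ν a + r → i + t * k + suc b ≡ part μ b + r →
               i + t * suc k < r + s → Moves i k (W ν) (W μ)
  hook⇒moves {ν} {μ} {a} {b} {i} {k} h i<t hx hy x<N = Moves-applyUpTo t i i<t
    (Move-applyUpTo (wordLength r s t i) k (position<⇒<wordLength i<t x<N)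
      (letter-false {ν} {i} {k} y∉f) (letter-true {ν} {i} {suc k} (a , hx))
      (letter-true {μ} {i} {k} (b , hy)) (letter-false {μ} {i} {suc k} x∉g)
      (λ j≢k j≢1+k → same i<t (j≢1+k ∘ proj₂) (j≢k ∘ proj₂)))
    (λ {i′} i′<t i′≢i → applyUpTo-congˡ (wordLength r s t i′)
      (λ _ → same i′<t (i′≢i ∘ proj₁) (i′≢i ∘ proj₁)))
    where
    open HookBeads (part-antitone ν) (part-antitone μ) h hx hy
    same : ∀ {i′ j} → i′ < t → ¬ (i′ ≡ i × j ≡ suc k) → ¬ (i′ ≡ i × j ≡ k) →
           letter ν i′ j ≡ letter μ i′ j
    same {i′} {j} i′<t ≢x ≢y = letter-cong {ν} {μ} {i′} {j}
      (bead-f⇒g (≢x ∘ position-injective i′<t i<t))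
      (bead-g⇒f (≢y ∘ position-injective i′<t i<t))

  private
    1≤t : 1 ≤ t
    1≤t = >-nonZero⁻¹ t

    step-position : ∀ i k → i + t * suc k ≡ i + t * k + t
    step-position i k = lemma i t k
      where
      lemma : ∀ i t k → i + t * suc k ≡ i + t * k + t
      lemma = solve-∀

  removes⇒∈𝒫 : ∀ {ν μ} → Removes t ν μ → ν ∈𝒫[ r , s ] → μ ∈𝒫[ r , s ]
  removes⇒∈𝒫 {ν} {μ} ((μ⊆ν , _) , _) ν∈ =
    nth≡0⇒length≤ (positive μ) (n≤0⇒n≡0 (subst (part μ r ≤_) (part≡0 {ν} ν∈ ≤-refl) (μ⊆ν r))) ,
    ≤-trans (μ⊆ν 0) (proj₂ ν∈)

  removes⇒moves : ∀ {ν μ} → Removes t ν μ → ν ∈𝒫[ r , s ] → ∃₂ λ i k → Moves i k (W ν) (W μ)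
  removes⇒moves {ν} {μ} rem ν∈ with removes⇒hook {t} {ν} {μ} 1≤t rem
  ... | a , b , h , eq = i , k , hook⇒moves {ν} {μ} h (m%n<n y t) hx hy (At-bound {ν} ν∈ (a , hx))
    where
    b<r : b < r
    b<r = ≰⇒> λ r≤b → n≮0 (subst (part μ b <_) (part≡0 {ν} ν∈ r≤b) (Hook.end h))
    -- The position of the new bead. It is nonnegative because row `b` of ν contains a box of the
    -- hook and hence `b < r`.
    y = part μ b + r ∸ suc b
    i = y % t
    k = y / t
    y≡ : i + t * k ≡ y
    y≡ = sym (trans (m≡m%n+[m/n]*n y t) (cong (_+_ i) (*-comm k t)))
    hy : i + t * k + suc b ≡ part μ b + r
    hy = trans (cong (_+ suc b) y≡) (m∸n+n≡m (≤-trans b<r (m≤n+m r (part μ b))))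
    -- Since the hook has `t` boxes, the vanishing bead was at `y + t`, the next letter on the same
    -- runner.
    hx : i + t * suc k + suc a ≡ part ν a + r
    hx = +-cancelʳ-≡ b _ _ (begin
      i + t * suc k + suc a + b         ≡⟨ lemma₁ i t k a b ⟩
      (i + t * k + suc b) + (t + a)     ≡⟨ cong (_+ (t + a)) hy ⟩
      part μ b + r + (t + a)            ≡⟨ lemma₂ (part μ b) r t a ⟩
      (part μ b + t + a) + r            ≡⟨ cong (_+ r) eq ⟩
      part ν a + b + r                  ≡⟨ lemma₃ (part ν a) b r ⟩
      part ν a + r + b                  ∎)
      where
      open ≡-Reasoning
      lemma₁ : ∀ i t k a b → i + t * suc k + suc a + b ≡ (i + t * k + suc b) + (t + a)
      lemma₁ = solve-∀
      lemma₂ : ∀ m r t a → m + r + (t + a) ≡ (m + t + a) + r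
      lemma₂ = solve-∀
      lemma₃ : ∀ m b r → m + b + r ≡ m + r + b
      lemma₃ = solve-∀

  removal-exists : ∀ {ν i k vs} → ν ∈𝒫[ r , s ] → Moves i k (W ν) vs → ∃ (Removes t ν)
  removal-exists {ν} {i} {k} ν∈ m = remove (Slide.slideDown r (i + t * k) t 1≤t
    (part-antitone ν) (part≡0 {ν} ν∈ ≤-refl)
    (subst (At r (part ν)) (step-position i k) (letter-true⁻ {ν} {i} {suc k} (proj₂ (proj₂ gap-bead))))
    (letter-false⁻ {ν} {i} {k} (proj₁ (proj₂ gap-bead))))
    where
    gap-bead : suc k < wordLength r s t i × letter ν i k ≡ false × letter ν i (suc k) ≡ true
    gap-bead = Move-source (wordLength r s t i) (proj₂ (proj₂ (Moves-source t m refl))) refl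

    remove : (∃ λ g → ∃₂ λ a b → Antitone g × Hook (part ν) g a b × g b + t + a ≡ part ν a + b) →
             ∃ (Removes t ν)
    remove (g , a , b , g-anti , h , eq)
      -- This index is past `b`, where `g` agrees with ν, and at least `r`, where ν is empty.
      with fromParts (suc b + r) g-anti
             (trans (sym (Hook.below h (m≤m+n (suc b) r))) (part≡0 {ν} ν∈ (m≤n+m r (suc b))))
    ... | μ , μ≗g , _ = μ , hook⇒removes {t} {ν} {μ} (Hook-cong (λ _ → refl) (sym ∘ μ≗g) h)
                              (trans (cong (λ z → z + t + a) (μ≗g b)) eq)

  -- The new partition stays in the box: the bead at a nonnegative position forces `b < r`, so no
  -- row is added from `r` on, and if the hook starts in row 0 then its bead below `r + s` bounds
  -- that row by `s`. Undoing a move is unambiguous, which identifies the new words with `us`.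
  addition-exists : ∀ {μ i k us} → μ ∈𝒫[ r , s ] → Moves i k us (W μ) →
                    ∃ λ ν → ν ∈𝒫[ r , s ] × Removes t ν μ × W ν ≡ us
  addition-exists {μ} {i} {k} {us} μ∈ m with Moves-target t m refl
  ... | i<t , _ , m′ with Move-target (wordLength r s t i) m′ refl
  ...   | k+1<n , y-bead , x-gap = add (letter-true⁻ {μ} {i} {k} y-bead)
    where
    Added = ∃ λ ν → ν ∈𝒫[ r , s ] × Removes t ν μ × W ν ≡ us

    x<N : i + t * suc k < r + s
    x<N = <wordLength⇒position< i<t k+1<n

    addHook : ∀ {ν a b} → Hook (part ν) (part μ) a b → length (parts ν) ≤ r →
              i + t * k + suc b ≡ part μ b + r → i + t * suc k + suc a ≡ part ν a + r → Added
    addHook {ν} {a} {b} h l≤r hy hx =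
      ν , (l≤r , first-row a h hx) , hook⇒removes {t} {ν} {μ} h eq ,
      Moves-injective (hook⇒moves {ν} {μ} h i<t hx hy x<N) m
      where
      first-row : ∀ a → Hook (part ν) (part μ) a b → i + t * suc k + suc a ≡ part ν a + r →
                  part ν 0 ≤ s
      first-row zero    _ hx = +-cancelʳ-≤ r _ _ (begin
        part ν 0 + r           ≡⟨ hx ⟨
        i + t * suc k + 1      ≡⟨ +-comm _ 1 ⟩
        suc (i + t * suc k)    ≤⟨ x<N ⟩
        r + s                  ≡⟨ +-comm r s ⟩
        s + r                  ∎)
        where open ≤-Reasoning
      first-row (suc _) h _  = subst (_≤ s) (sym (Hook.above h z<s)) (proj₂ μ∈)

      eq : part μ b + t + a ≡ part ν a + b
      eq = +-cancelʳ-≡ r _ _ (begin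
        part μ b + t + a + r              ≡⟨ lemma₁ (part μ b) t a r ⟩
        part μ b + r + (t + a)            ≡⟨ cong (_+ (t + a)) hy ⟨
        i + t * k + suc b + (t + a)       ≡⟨ lemma₂ i t k a b ⟩
        i + t * suc k + suc a + b         ≡⟨ cong (_+ b) hx ⟩
        part ν a + r + b                  ≡⟨ lemma₃ (part ν a) r b ⟩
        part ν a + b + r                  ∎)
        where
        open ≡-Reasoning
        lemma₁ : ∀ m t a r → m + t + a + r ≡ m + r + (t + a)
        lemma₁ = solve-∀
        lemma₂ : ∀ i t k a b → i + t * k + suc b + (t + a) ≡ i + t * suc k + suc a + b
        lemma₂ = solve-∀
        lemma₃ : ∀ m b r → m + b + r ≡ m + r + b
        lemma₃ = solve-∀

    addSlid : ((b , _) : At r (part μ) (i + t * k)) →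
              (∃₂ λ f a → Antitone f × Hook f (part μ) a b × i + t * k + t + suc a ≡ f a + r) →
              Added
    addSlid (b , hy) (f , a , f-anti , h , hx)
      with fromParts r f-anti
             (trans (Hook.below h (At-row {μ} μ∈ {i + t * k} (b , hy))) (part≡0 {μ} μ∈ ≤-refl))
    ... | ν , ν≗f , l≤r = addHook {ν} (Hook-cong (sym ∘ ν≗f) (λ _ → refl) h) l≤r hy
      (trans (cong (_+ suc a) (step-position i k)) (trans hx (cong (_+ r) (sym (ν≗f a)))))

    add : At r (part μ) (i + t * k) → Added
    add at = addSlid at (Slide.slideUp r (i + t * k) t 1≤t (part-antitone μ)
      (subst (¬_ ∘ At r (part μ)) (step-position i k) (letter-false⁻ {μ} {i} {suc k} x-gap)) at)

  -- Invariants of removals, and partitions rebuilt from words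

  removals-invariant : ∀ {ν ρ} → Star (Removes t) ν ρ → ν ∈𝒫[ r , s ] →
                       map length (W ν) ≡ map length (W ρ) × map ones (W ν) ≡ map ones (W ρ)
  removals-invariant ε _ = refl , refl
  removals-invariant {ν} (_◅_ {j = μ} rem rems) ν∈ =
    trans (Moves-lengths move) (proj₁ rest) , trans (Moves-ones move) (proj₂ rest)
    where
    move = proj₂ (proj₂ (removes⇒moves {ν} {μ} rem ν∈))
    rest = removals-invariant rems (removes⇒∈𝒫 {ν} {μ} rem ν∈)

  module _ {ρ : Partition} (ρ∈ : ρ ∈𝒫[ r , s ]) (core : ¬ ∃ (Removes t ρ)) where

    core⇒Inv≡0 : Inv (W ρ) ≡ 0
    core⇒Inv≡0 with Inv (W ρ) ≟ 0
    ... | yes z = z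
    ... | no nz with Moves-exists (W ρ) nz
    ...   | _ , _ , _ , m = contradiction (removal-exists {ρ} ρ∈ m) core

    -- Here `n` stands for `Inv us`. It is a separate argument so that `fromWords` can recurse on
    -- it.
    FromWords : ℕ → List (List Bool) → Partition → Set
    FromWords n us ν = ν ∈𝒫[ r , s ] × Star (Removes t) ν ρ × W ν ≡ us × size ν ≡ size ρ + t * n

    fromWords : ∀ n {us} → Inv us ≡ n → map length us ≡ map length (W ρ) →
                map ones us ≡ map ones (W ρ) → ∃ (FromWords n us)
    fromWords zero    z ls os = ρ , ρ∈ , ε , sym (Inv≡0-unique z core⇒Inv≡0 ls os) ,
      sym (trans (cong (_+_ (size ρ)) (*-zeroʳ t)) (+-identityʳ _))
    fromWords (suc n) {us} eq ls os with Moves-exists us (λ z → contradiction (trans (sym eq) z) λ ())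
    ... | i , k , vs , m = extend (fromWords n {vs} (suc-injective (trans (sym (Moves-Inv m)) eq))
      (trans (sym (Moves-lengths m)) ls) (trans (sym (Moves-ones m)) os))
      where
      extend : ∃ (FromWords n vs) → ∃ (FromWords (suc n) us)
      extend (μ , μ∈ , rems , W≡ , size≡) = add (addition-exists {μ} μ∈ (subst (Moves i k us) (sym W≡) m))
        where
        add : (∃ λ ν → ν ∈𝒫[ r , s ] × Removes t ν μ × W ν ≡ us) → ∃ (FromWords (suc n) us)
        add (ν , ν∈ , rem , W≡′) = ν , ν∈ , rem ◅ rems , W≡′ , (begin
          size ν                ≡⟨ proj₂ rem ⟩
          size μ + t            ≡⟨ cong (_+ t) size≡ ⟩
          size ρ + t * n + t    ≡⟨ lemma (size ρ) t n ⟩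
          size ρ + t * suc n    ∎)
          where
          open ≡-Reasoning
          lemma : ∀ m t n → m + t * n + t ≡ m + t * suc n
          lemma = solve-∀

-- Enumeration of words and tuples of words

-- The clauses follow those of `gauss`, so that the q-Pascal rule becomes a split by the first
-- letter: a leading 0 precedes `suc k` ones and contributes the factor `q ^ suc k`.
binaryWords : ℕ → ℕ → List (List Bool)
binaryWords n       zero    = replicate n false ∷ []
binaryWords zero    (suc k) = []
binaryWords (suc n) (suc k) = map (true ∷_) (binaryWords n k) ++ map (false ∷_) (binaryWords n (suc k))

∈-binaryWords⁺ : ∀ v → v ∈ binaryWords (length v) (ones v)
∈-binaryWords⁺ []          = here refl
∈-binaryWords⁺ (true ∷ v)  = ∈-++⁺ˡ (∈-map⁺ (true ∷_) (∈-binaryWords⁺ v))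
∈-binaryWords⁺ (false ∷ v) with ones v in eq | ∈-binaryWords⁺ v
... | zero  | here v≡  = here (cong (false ∷_) v≡)
... | suc k | v∈       = ∈-++⁺ʳ (map (true ∷_) (binaryWords (length v) k)) (∈-map⁺ (false ∷_) v∈)

length-replicate-false : ∀ n → length (replicate n false) ≡ n × ones (replicate n false) ≡ 0
length-replicate-false zero    = refl , refl
length-replicate-false (suc n) with length-replicate-false n
... | l , o = cong suc l , o

inv-replicate-false : ∀ n → inv (replicate n false) ≡ 0
inv-replicate-false zero    = refl
inv-replicate-false (suc n) = cong₂ _+_ (proj₂ (length-replicate-false n)) (inv-replicate-false n)

∈-binaryWords⁻ : ∀ n k {v} → v ∈ binaryWords n k → length v ≡ n × ones v ≡ k
∈-binaryWords⁻ n zero (here refl) = length-replicate-false n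
∈-binaryWords⁻ (suc n) (suc k) v∈ with ∈-++⁻ (map (true ∷_) (binaryWords n k)) v∈
... | inj₁ v∈₁ with ∈-map⁻ (true ∷_) v∈₁
...   | u , u∈ , refl with ∈-binaryWords⁻ n k u∈
...     | l , o = cong suc l , cong suc o
∈-binaryWords⁻ (suc n) (suc k) v∈ | inj₂ v∈₂ with ∈-map⁻ (false ∷_) v∈₂
...   | u , u∈ , refl with ∈-binaryWords⁻ n (suc k) u∈
...     | l , o = cong suc l , o

binaryWords-unique : ∀ n k → Unique (binaryWords n k)
binaryWords-unique n       zero    = [] ∷ []
binaryWords-unique zero    (suc k) = []
binaryWords-unique (suc n) (suc k) = Unique.++⁺
  (Unique.map⁺ (proj₂ ∘ ∷-injective) (binaryWords-unique n k))
  (Unique.map⁺ (proj₂ ∘ ∷-injective) (binaryWords-unique n (suc k)))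
  λ (v∈₁ , v∈₂) → case ∈-map⁻ (true ∷_) v∈₁ , ∈-map⁻ (false ∷_) v∈₂ of
    λ { ((_ , _ , refl) , (_ , _ , ())) }

wordTuples : ℕ → (ℕ → ℕ) → (ℕ → ℕ) → List (List (List Bool))
wordTuples zero    N A = [] ∷ []
wordTuples (suc m) N A =
  cartesianProductWith _∷_ (binaryWords (N 0) (A 0)) (wordTuples m (N ∘ suc) (A ∘ suc))

∈-wordTuples⁺ : ∀ m {N A} us → map length us ≡ applyUpTo N m → map ones us ≡ applyUpTo A m →
                us ∈ wordTuples m N A
∈-wordTuples⁺ zero    []       _  _  = here refl
∈-wordTuples⁺ (suc m) (u ∷ us) ls os with ∷-injective ls | ∷-injective os
... | l , ls′ | o , os′ = ∈-cartesianProductWith⁺ _∷_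
  (subst₂ (λ n k → u ∈ binaryWords n k) l o (∈-binaryWords⁺ u)) (∈-wordTuples⁺ m us ls′ os′)

∈-wordTuples⁻ : ∀ m {N A us} → us ∈ wordTuples m N A →
                map length us ≡ applyUpTo N m × map ones us ≡ applyUpTo A m
∈-wordTuples⁻ zero (here refl) = refl , refl
∈-wordTuples⁻ (suc m) {N} {A} us∈
  with ∈-cartesianProductWith⁻ _∷_ (binaryWords (N 0) (A 0)) (wordTuples m (N ∘ suc) (A ∘ suc)) us∈
... | u , us , u∈ , us∈′ , refl with ∈-binaryWords⁻ (N 0) (A 0) u∈ | ∈-wordTuples⁻ m us∈′
...   | l , o | ls , os = cong₂ _∷_ l ls , cong₂ _∷_ o os

wordTuples-unique : ∀ m N A → Unique (wordTuples m N A)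
wordTuples-unique zero    N A = [] ∷ []
wordTuples-unique (suc m) N A = Unique.cartesianProductWith⁺ _∷_ ∷-injective
  (binaryWords-unique (N 0) (A 0)) (wordTuples-unique m (N ∘ suc) (A ∘ suc))

-- Generating functions

module GeneratingFunctions {c ℓ} (R : CommutativeSemiring c ℓ) where
  private module C = CommutativeSemiring R
  open C using (Carrier; _≈_; setoid; semiring) renaming (_+_ to _⊕_; _*_ to _⊛_)
  open QPoly R
  open import Algebra.Properties.Semiring.Exp semiring using (^-homo-*)
  open import Relation.Binary.Reasoning.Setoid setoid

  ∑-cong : ∀ {a} {A : Set a} (xs : List A) {f g : A → Carrier} →
           (∀ {x} → x ∈ xs → f x ≈ g x) → ∑ xs f ≈ ∑ xs g
  ∑-cong []       _  = C.refl
  ∑-cong (x ∷ xs) eq = C.+-cong (eq (here refl)) (∑-cong xs (eq ∘ there))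

  ∑-++ : ∀ {a} {A : Set a} (xs ys : List A) {f : A → Carrier} → ∑ (xs ++ ys) f ≈ ∑ xs f ⊕ ∑ ys f
  ∑-++ []       ys     = C.sym (C.+-identityˡ _)
  ∑-++ (x ∷ xs) ys {f} = C.trans (C.+-congˡ (∑-++ xs ys)) (C.sym (C.+-assoc (f x) _ _))

  ∑-map : ∀ {a b} {A : Set a} {B : Set b} (g : A → B) xs {f : B → Carrier} →
          ∑ (map g xs) f ≡ ∑ xs (f ∘ g)
  ∑-map g []           = refl
  ∑-map g (x ∷ xs) {f} = cong (f (g x) ⊕_) (∑-map g xs)

  ∑-distribˡ : ∀ {a} {A : Set a} (xs : List A) {f : A → Carrier} d →
               ∑ xs (λ x → d ⊛ f x) ≈ d ⊛ ∑ xs f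
  ∑-distribˡ []       d = C.sym (C.zeroʳ d)
  ∑-distribˡ (x ∷ xs) d = C.trans (C.+-congˡ (∑-distribˡ xs d)) (C.sym (C.distribˡ d _ _))

  ∑-cartesianProductWith : ∀ {a b c} {A : Set a} {B : Set b} {C : Set c} (h : A → B → C) xs ys
    {f : A → Carrier} {g : B → Carrier} {F : C → Carrier} → (∀ x y → F (h x y) ≈ f x ⊛ g y) →
    ∑ (cartesianProductWith h xs ys) F ≈ ∑ xs f ⊛ ∑ ys g
  ∑-cartesianProductWith h []       ys _ = C.sym (C.zeroˡ _)
  ∑-cartesianProductWith h (x ∷ xs) ys {f} {g} {F} eq = begin
    ∑ (map (h x) ys ++ cartesianProductWith h xs ys) F
      ≈⟨ ∑-++ (map (h x) ys) _ ⟩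
    ∑ (map (h x) ys) F ⊕ ∑ (cartesianProductWith h xs ys) F
      ≈⟨ C.+-cong (C.reflexive (∑-map (h x) ys)) (∑-cartesianProductWith h xs ys eq) ⟩
    ∑ ys (F ∘ h x) ⊕ ∑ xs f ⊛ ∑ ys g
      ≈⟨ C.+-cong (C.trans (∑-cong ys (λ {y} _ → eq x y)) (∑-distribˡ ys (f x))) C.refl ⟩
    f x ⊛ ∑ ys g ⊕ ∑ xs f ⊛ ∑ ys g
      ≈⟨ C.distribʳ _ _ _ ⟨
    (f x ⊕ ∑ xs f) ⊛ ∑ ys g ∎

  ∑-binaryWords : ∀ q n k → ∑ (binaryWords n k) (λ v → q ^ inv v) ≈ gauss q n k
  ∑-binaryWords q n       zero    = C.trans (C.+-identityʳ _)
    (C.reflexive (cong (q ^_) (inv-replicate-false n)))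
  ∑-binaryWords q zero    (suc k) = C.refl
  ∑-binaryWords q (suc n) (suc k) = begin
    ∑ (map (true ∷_) us ++ map (false ∷_) vs) f
      ≈⟨ ∑-++ (map (true ∷_) us) _ ⟩
    ∑ (map (true ∷_) us) f ⊕ ∑ (map (false ∷_) vs) f
      ≈⟨ C.+-cong (C.reflexive (∑-map (true ∷_) us)) (C.reflexive (∑-map (false ∷_) vs)) ⟩
    ∑ us f ⊕ ∑ vs (λ v → q ^ (ones v + inv v))
      ≈⟨ C.+-cong (∑-binaryWords q n k) (∑-cong vs power) ⟩
    gauss q n k ⊕ ∑ vs (λ v → q ^ suc k ⊛ q ^ inv v)
      ≈⟨ C.+-congˡ (∑-distribˡ vs (q ^ suc k)) ⟩
    gauss q n k ⊕ q ^ suc k ⊛ ∑ vs f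
      ≈⟨ C.+-congˡ (C.*-congˡ (∑-binaryWords q n (suc k))) ⟩
    gauss q n k ⊕ q ^ suc k ⊛ gauss q n (suc k) ∎
    where
    us = binaryWords n k
    vs = binaryWords n (suc k)
    f  = λ v → q ^ inv v
    power : ∀ {v} → v ∈ vs → q ^ (ones v + inv v) ≈ q ^ suc k ⊛ q ^ inv v
    power {v} v∈ = C.trans (^-homo-* q (ones v) (inv v))
      (C.*-congʳ (C.reflexive (cong (q ^_) (proj₂ (∈-binaryWords⁻ n (suc k) v∈)))))

  ∑-wordTuples : ∀ q m N A → ∑ (wordTuples m N A) (λ us → q ^ Inv us) ≈ ∏ m (λ i → gauss q (N i) (A i))
  ∑-wordTuples q zero    N A = C.+-identityʳ _
  ∑-wordTuples q (suc m) N A = C.trans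
    (∑-cartesianProductWith _∷_ (binaryWords (N 0) (A 0)) (wordTuples m (N ∘ suc) (A ∘ suc))
      (λ u us → ^-homo-* q (inv u) (Inv us)))
    (C.*-cong (∑-binaryWords q (N 0) (A 0)) (∑-wordTuples q m (N ∘ suc) (A ∘ suc)))

-- The partitions in the box with core ρ

module _ {a b p} {A : Set a} {B : Set b} {Q : A → B → Set p} where

  choose : ∀ xs → (∀ {x} → x ∈ xs → ∃ (Q x)) → ∃ (Pointwise Q xs)
  choose []       _  = [] , []
  choose (x ∷ xs) Qs with Qs (here refl) | choose xs (Qs ∘ there)
  ... | y , Qxy | ys , Qxsys = y ∷ ys , Qxy ∷ Qxsys

  Pointwise-∈ˡ : ∀ {xs ys} → Pointwise Q xs ys → ∀ {x} → x ∈ xs → ∃ λ y → y ∈ ys × Q x y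
  Pointwise-∈ˡ (Qxy ∷ _) (here refl) = _ , here refl , Qxy
  Pointwise-∈ˡ (_ ∷ Qs)  (there x∈)  with Pointwise-∈ˡ Qs x∈
  ... | y , y∈ , Qxy = y , there y∈ , Qxy

  Pointwise-∈ʳ : ∀ {xs ys} → Pointwise Q xs ys → ∀ {y} → y ∈ ys → ∃ λ x → x ∈ xs × Q x y
  Pointwise-∈ʳ (Qxy ∷ _) (here refl) = _ , here refl , Qxy
  Pointwise-∈ʳ (_ ∷ Qs)  (there y∈)  with Pointwise-∈ʳ Qs y∈
  ... | x , x∈ , Qxy = x , there x∈ , Qxy

module CoreFibre (r s t : ℕ) .{{_ : NonZero t}} (ρ : Partition)
  (ρ∈ : ρ ∈𝒫[ r , s ]) (core : ¬ ∃ (Removes t ρ)) where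
  open Runners r s t
  open Nat using (_*_)

  tuples : List (List (List Bool))
  tuples = wordTuples t (λ i → wordLength r s t i) (λ i → ones (word r s t ρ i))

  HasWords : List (List Bool) → Partition → Set
  HasWords us = FromWords {ρ} ρ∈ core (Inv us) us

  W-lengths : ∀ ν → map length (W ν) ≡ applyUpTo (λ i → wordLength r s t i) t
  W-lengths ν = trans (map-applyUpTo _ length t)
    (applyUpTo-congˡ t λ {i} _ → length-applyUpTo (letter ν i) (wordLength r s t i))

  W-ones : map ones (W ρ) ≡ applyUpTo (λ i → ones (word r s t ρ i)) t
  W-ones = trans (map-applyUpTo _ ones t)
    (applyUpTo-congˡ t λ {i} _ → cong ones (sym (word≡letters ρ i)))

  realize : ∀ {us} → us ∈ tuples → ∃ (HasWords us)
  realize us∈ with ∈-wordTuples⁻ t us∈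
  ... | ls , os = fromWords {ρ} ρ∈ core _ refl (trans ls (sym (W-lengths ρ))) (trans os (sym W-ones))

  fibre : List Partition
  fibre = proj₁ (choose tuples realize)

  fibre-words : Pointwise HasWords tuples fibre
  fibre-words = proj₂ (choose tuples realize)

  fibre-enumerates : Enumerates fibre (𝒟 t r s ρ)
  -- `W` maps `fibre` back onto the list of tuples, so a repeated partition would give a repeated
  -- tuple.
  fibre-enumerates = Unique.map⁻ (subst Unique (sym (map-W fibre-words)) (wordTuples-unique t _ _)) ,
                     λ ν → mk⇔ sound complete
    where
    map-W : ∀ {uss νs} → Pointwise HasWords uss νs → map W νs ≡ uss
    map-W []                        = refl
    map-W ((_ , _ , eq , _) ∷ rest) = cong₂ _∷_ eq (map-W rest)

    sound : ∀ {ν} → ν ∈ fibre → 𝒟 t r s ρ ν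
    sound ν∈ with Pointwise-∈ʳ fibre-words ν∈
    ... | _ , _ , ν∈𝒫 , rems , _ = ν∈𝒫 , rems , core

    complete : ∀ {ν} → 𝒟 t r s ρ ν → ν ∈ fibre
    complete {ν} (ν∈𝒫 , rems , _)
      -- The removals from ν to ρ preserve the numbers of ones, so `W ν` is among the tuples; the
      -- partition chosen for it has the same words and is therefore ν.
      with Pointwise-∈ˡ fibre-words (∈-wordTuples⁺ t (W ν) (W-lengths ν)
             (trans (proj₂ (removals-invariant rems ν∈𝒫)) W-ones))
    ... | ν′ , ν′∈ , ν′∈𝒫 , _ , eq , _ = subst (_∈ fibre) (W-injective ν′∈𝒫 ν∈𝒫 eq) ν′∈

  module _ {c ℓ} (R : CommutativeSemiring c ℓ) where
    private module C = CommutativeSemiring R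
    open C using (_≈_; setoid; semiring) renaming (_*_ to _⊛_)
    open QPoly R
    open GeneratingFunctions R
    open import Algebra.Properties.Semiring.Exp semiring using (^-homo-*; ^-assocʳ)
    open import Relation.Binary.Reasoning.Setoid setoid

    ∑-fibre : ∀ q → ∑ fibre (λ ν → q ^ size ν) ≈
              q ^ size ρ ⊛ ∏ t (λ i → gauss (q ^ t) (wordLength r s t i) (ones (word r s t ρ i)))
    ∑-fibre q = begin
      ∑ fibre (λ ν → q ^ size ν)
        ≈⟨ ∑-words fibre-words ⟩
      ∑ tuples (λ us → q ^ size ρ ⊛ (q ^ t) ^ Inv us)
        ≈⟨ ∑-distribˡ tuples (q ^ size ρ) ⟩
      q ^ size ρ ⊛ ∑ tuples (λ us → (q ^ t) ^ Inv us)
        ≈⟨ C.*-congˡ (∑-wordTuples (q ^ t) t _ _) ⟩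
      q ^ size ρ ⊛ ∏ t (λ i → gauss (q ^ t) (wordLength r s t i) (ones (word r s t ρ i))) ∎
      where
      ∑-words : ∀ {uss νs} → Pointwise HasWords uss νs →
                ∑ νs (λ ν → q ^ size ν) ≈ ∑ uss (λ us → q ^ size ρ ⊛ (q ^ t) ^ Inv us)
      ∑-words []                                      = C.refl
      ∑-words (_∷_ {x = us} (_ , _ , _ , size≡) rest) = C.+-cong
        (C.trans (C.reflexive (cong (q ^_) size≡))
          (C.trans (^-homo-* q (size ρ) _) (C.*-congˡ (C.sym (^-assocʳ q t (Inv us))))))
        (∑-words rest)

theorem4p1 : ∀ {c ℓ : Level} (r s t : ℕ) .{{_ : NonZero t}} →
  1 ≤ r → 1 ≤ s → 2 ≤ t →
  (ρ : Partition) → ρ ∈𝒫[ r , s ] → IsCore t ρ →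
  ∃ λ (L : List Partition) →
    Enumerates L (𝒟 t r s ρ) ×
    ((R : CommutativeSemiring c ℓ) →
     let open CommutativeSemiring R
         open QPoly R
     in (q : Carrier) →
        ∑ L (λ ν → q ^ size ν)
          ≈ q ^ size ρ *
            ∏ t (λ i → gauss (q ^ t) (wordLength r s t i) (ones (word r s t ρ i))))
theorem4p1 r s t _ _ _ ρ ρ∈ (_ , core) = fibre , fibre-enumerates , ∑-fibre
  where open CoreFibre r s t ρ ρ∈ core
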